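{- Let $g_0(n)$ denote the maximum integer $g$ such that there exists a graph $G$ on $n$ vertices with $\mathrm{girth}(G)\geq g$ and $\pi(G)=n$. There exist $n_0$ and $c>0$ such that, for every $n\geq n_0$, $$g_0(n)\geq c\sqrt{\lg n}\,,$$ where $\lg$ denotes the base-2 logarithm.
   Context: Pebbling: a pebbling configuration on a graph $G$ is a distribution of pebbles to the vertices of $G$. A pebbling step removes two pebbles from a vertex $v$ that has at least two pebbles and places one pebble on a neighbor of $v$. Given a root vertex $r$, a configuration is $r$-solvable if some sequence of pebbling steps places a pebble on $r$; it is solvable if it is $r$-solvable for every vertex $r$. The pebbling number $\pi(G)$ is the least integer $\pi$ such that every configuration of $\pi$ pebbles on $G$ is solvable. The girth of a graph is the length of its shortest cycle. -}

module Defs where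

open import Data.Nat using (ℕ; zero; suc; _+_; _*_; _∸_; _≤_; _<_)
open import Data.Fin using (Fin; fromℕ; inject₁; _≟_)
import Data.Fin as F
open import Data.List using (tabulate)
open import Data.Nat.ListAction using (sum)
open import Data.Empty using (⊥)
open import Data.Product using (Σ; ∃; _×_; _,_)
open import Relation.Nullary using (¬_; yes; no)
open import Relation.Binary.PropositionalEquality using (_≡_)
open import Relation.Binary.Construct.Closure.ReflexiveTransitive using (Star)
open import Function.Definitions using (Injective)

record Graph (n : ℕ) : Set₁ where
  field
    Adj   : Fin n → Fin n → Set
    sym   : ∀ {u v} → Adj u v → Adj v u
    irrefl : ∀ {u} → ¬ Adj u u
open Graph public

Config : ℕ → Set
Config n = Fin n → ℕ

size : ∀ {n} → Config n → ℕ
size {n} C = sum (tabulate C)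

[_≡?_] : ∀ {n} → Fin n → Fin n → ℕ
[ w ≡? u ] with w ≟ u
... | yes _ = 1
... | no  _ = 0

move : ∀ {n} → Config n → Fin n → Fin n → Config n
move C u v w = (C w ∸ 2 * [ w ≡? u ]) + [ w ≡? v ]

data Step {n} (G : Graph n) (C : Config n) : Config n → Set where
  step : (u v : Fin n) → Adj G u v → 2 ≤ C u → Step G C (move C u v)

RSolvable : ∀ {n} → Graph n → Config n → Fin n → Set
RSolvable G C r = Σ (Config _) λ D → Star (Step G) C D × 1 ≤ D r

Solvable : ∀ {n} → Graph n → Config n → Set
Solvable G C = ∀ r → RSolvable G C r

AllSolvable : ∀ {n} → Graph n → ℕ → Set
AllSolvable {n} G p = ∀ (C : Config n) → size C ≡ p → Solvable G C

PebblingNumberIs : ∀ {n} → Graph n → ℕ → Set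
PebblingNumberIs {n} G p =
  AllSolvable G p ×
  (∀ m → m < p → Σ (Config n) λ C → size C ≡ m × ¬ Solvable G C)

HasCycle : ∀ {n} → Graph n → ℕ → Set
HasCycle {n} G zero = ⊥
HasCycle {n} G (suc m) =
  3 ≤ suc m ×
  Σ (Fin (suc m) → Fin n) λ f →
    Injective _≡_ _≡_ f ×
    (∀ (i : Fin m) → Adj G (f (inject₁ i)) (f (F.suc i))) ×
    Adj G (f (fromℕ m)) (f F.zero)

-- girth(G) ≥ g : every cycle has length at least g
-- (vacuous for acyclic graphs, whose girth is ∞).
GirthAtLeast : ∀ {n} → Graph n → ℕ → Set
GirthAtLeast G g = ∀ k → HasCycle G k → g ≤ k

{-# OPTIONS --safe #-}
module Submission where

open import Defs hiding (sym)
open import Data.Bool using (Bool; true; false; _∧_; _∨_; not; if_then_else_)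
open import Data.Empty using (⊥; ⊥-elim)
open import Data.Fin using (Fin; toℕ)
import Data.Fin as F
import Data.Fin.Properties as FP
open import Data.List using (List; []; _∷_; _++_; map; length; filter; replicate; concatMap; cartesianProduct; allFin)
open import Data.List.Membership.Propositional using (_∈_)
open import Data.List.Membership.Propositional.Properties using (∈-++⁺ˡ; ∈-++⁺ʳ; ∈-map⁺; ∈-filter⁺; ∈-cartesianProduct⁺)
open import Data.List.Properties using (length-++; length-map; length-replicate; length-filter; length-tabulate; map-tabulate; map-++)
import Data.List.Relation.Unary.All as All
open import Data.List.Relation.Unary.All using (All; []; _∷_)
open import Data.List.Relation.Unary.All.Properties using (all-filter)
open import Data.List.Relation.Unary.Any using (here; there)
open import Data.Nat
open import Data.Nat.DivMod using (_/_; _%_; m≡m%n+[m/n]*n; m%n<n; m/n*n≤m)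
open import Data.Nat.ListAction using (sum)
open import Data.Nat.ListAction.Properties using (sum-++)
open import Data.Nat.Properties
open import Data.Nat.Tactic.RingSolver using (solve-∀)
open import Data.Product using (Σ; ∃; _×_; _,_; proj₁; proj₂)
open import Data.Sum using (_⊎_; inj₁; inj₂)
import Data.Vec.Functional as V
open import Function using (_∘_)
open import Relation.Binary.Construct.Closure.ReflexiveTransitive using (Star; ε; _◅_; _◅◅_)
open import Relation.Binary.PropositionalEquality
open import Relation.Nullary using (¬_; Dec; yes; no; does; contradiction; _×-dec_)
open import Relation.Nullary.Decidable using (dec-true; dec-false)

-- Let s = 2^d, where d bounds the diameter, and suppose that small vertex sets expand by a
-- factor K = 8s². A configuration of n pebbles with z empty vertices and no vertex holding
-- s pebbles has at least z/s vertices with two or more pebbles, and such a vertex can send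
-- a pebble for free along a path of occupied vertices. If there are fewer than s of them,
-- the few empty vertices cannot separate one of them from the root. Otherwise s disjoint
-- groups are grown from them in parallel through occupied vertices, expansion always
-- outrunning the empty and the already used vertices, until all s groups have a common
-- neighbour; it collects s pebbles, enough to reach the root.
--
-- A graph of large girth that expands is built greedily: every vertex chooses D neighbours,
-- each far away and of bounded indegree, and the method of conditional expectations keeps
-- the expected number of violations (A, T) of expansion ("all choices of A lie in T") below 1.
-- With log s and log D of order g, girth g is possible as soon as log n is of order g².

-- Finite sums, sets and balls

-- The square root comes from a circular dependence of the parameters. Crossing the diameter d costs
-- s = 2^d pebbles, the parallel growth needs K of order s² = 4^d, and expansion by K in turn only
-- gives d of order 2 log n / log K. So lg K is about 2d, and lg n is of order d · lg K, that is d².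
-- Hence K must be as large as 2 to the power of order √(lg n). The union bound asks for a degree a
-- little above s · K · lg n, still of that form, and girth g asks that balls of radius g stay below
-- n; both leave g of order √(lg n). The two factors s in K have different origins. One comes from
-- the count of empty vertices, z ≤ s · b for b vertices with two or more pebbles; the other from
-- the s groups growing together: once b falls below s(m+1) for groups of size m, there are up to
-- s²(m+1) empty vertices to avoid. No set expands beyond n, so expansion is only asked up to n - h.
-- The bound 4sh ≤ n is what still leaves s large neighbourhoods a common vertex.

size-mono : ∀ {n} {f g : Fin n → ℕ} → (∀ i → f i ≤ g i) → size f ≤ size g
size-mono {zero}  f≤g = z≤n
size-mono {suc n} f≤g = +-mono-≤ (f≤g F.zero) (size-mono (f≤g ∘ F.suc))

size-cong : ∀ {n} {f g : Fin n → ℕ} → (∀ i → f i ≡ g i) → size f ≡ size g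
size-cong f≡g = ≤-antisym (size-mono (≤-reflexive ∘ f≡g)) (size-mono (≤-reflexive ∘ sym ∘ f≡g))

size-+ : ∀ {n} (f g : Fin n → ℕ) → size (λ i → f i + g i) ≡ size f + size g
size-+ {zero}  f g = refl
size-+ {suc n} f g =
  trans (cong (f F.zero + g F.zero +_) (size-+ (f ∘ F.suc) (g ∘ F.suc)))
        (interchange (f F.zero) (g F.zero) (size (f ∘ F.suc)) (size (g ∘ F.suc)))
  where
  interchange : ∀ a b c d → (a + b) + (c + d) ≡ (a + c) + (b + d)
  interchange = solve-∀

size-* : ∀ {n} c (f : Fin n → ℕ) → size (λ i → c * f i) ≡ c * size f
size-* {zero}  c f = sym (*-zeroʳ c)
size-* {suc n} c f =
  trans (cong (c * f F.zero +_) (size-* c (f ∘ F.suc))) (sym (*-distribˡ-+ c (f F.zero) _))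

size-const : ∀ {n} c → size {n} (λ _ → c) ≡ n * c
size-const {zero}  c = refl
size-const {suc n} c = cong (c +_) (size-const {n} c)

size-0 : ∀ {n} → size {n} (λ _ → 0) ≡ 0
size-0 {n} = trans (size-const {n} 0) (*-zeroʳ n)

size-1 : ∀ {n} → size {n} (λ _ → 1) ≡ n
size-1 {n} = trans (size-const {n} 1) (*-identityʳ n)

size-swap : ∀ {m n} (f : Fin m → Fin n → ℕ) →
  size (λ i → size (f i)) ≡ size (λ j → size (λ i → f i j))
size-swap {zero}  {n} f = sym (size-0 {n})
size-swap {suc m} f = trans (cong (size (f F.zero) +_) (size-swap (f ∘ F.suc)))
  (sym (size-+ (f F.zero) (λ j → size (λ i → f (F.suc i) j))))

≤-size : ∀ {n} (f : Fin n → ℕ) i → f i ≤ size f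
≤-size f F.zero    = m≤m+n _ _
≤-size f (F.suc i) = ≤-trans (≤-size (f ∘ F.suc) i) (m≤n+m _ _)

size-< : ∀ {n} {f g : Fin n → ℕ} → size f < size g → ∃ λ i → f i < g i
size-< {suc n} {f} {g} f<g with f F.zero <? g F.zero
... | yes p = F.zero , p
... | no ¬p with size-< {f = f ∘ F.suc} {g ∘ F.suc} rest
  where
  rest : size (f ∘ F.suc) < size (g ∘ F.suc)
  rest = +-cancelˡ-< (f F.zero) _ _ (<-≤-trans f<g (+-monoˡ-≤ _ (≮⇒≥ ¬p)))
... | i , q = F.suc i , q

[≡?]-refl : ∀ {n} (a : Fin n) → [ a ≡? a ] ≡ 1
[≡?]-refl a with a F.≟ a
... | yes _  = refl
... | no a≢a = contradiction refl a≢a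

[≡?]-≢ : ∀ {n} {a b : Fin n} → a ≢ b → [ a ≡? b ] ≡ 0
[≡?]-≢ {a = a} {b} a≢b with a F.≟ b
... | yes a≡b = contradiction a≡b a≢b
... | no _    = refl

[≡?]-suc : ∀ {n} (a b : Fin n) → [ F.suc a ≡? F.suc b ] ≡ [ a ≡? b ]
[≡?]-suc a b with a F.≟ b
... | yes refl = refl
... | no a≢b   = refl

size-[≡?] : ∀ {n} (a : Fin n) → size (λ v → [ v ≡? a ]) ≡ 1
size-[≡?] {suc n} F.zero    = cong suc (size-0 {n})
size-[≡?] {suc n} (F.suc a) = trans (size-cong (λ v → [≡?]-suc v a)) (size-[≡?] a)

[≡?]-sym : ∀ {n} (a b : Fin n) → [ a ≡? b ] ≡ [ b ≡? a ]
[≡?]-sym a b with a F.≟ b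
... | yes refl = sym ([≡?]-refl a)
... | no a≢b   = sym ([≡?]-≢ (a≢b ∘ sym))

⟦_⟧ : Bool → ℕ
⟦ true ⟧  = 1
⟦ false ⟧ = 0

count : ∀ {n} → (Fin n → Bool) → ℕ
count p = size (λ v → ⟦ p v ⟧)

⟦⟧≤1 : ∀ b → ⟦ b ⟧ ≤ 1
⟦⟧≤1 true  = ≤-refl
⟦⟧≤1 false = z≤n

⟦⟧-mono : ∀ {a b} → (a ≡ true → b ≡ true) → ⟦ a ⟧ ≤ ⟦ b ⟧
⟦⟧-mono {false} _ = z≤n
⟦⟧-mono {true} {true} _ = ≤-refl
⟦⟧-mono {true} {false} h with h refl
... | ()

⟦∨⟧ : ∀ a b → ⟦ a ∨ b ⟧ ≤ ⟦ a ⟧ + ⟦ b ⟧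
⟦∨⟧ true  b = s≤s z≤n
⟦∨⟧ false b = ≤-refl

⟦⟧+⟦not⟧ : ∀ b → ⟦ b ⟧ + ⟦ not b ⟧ ≡ 1
⟦⟧+⟦not⟧ true  = refl
⟦⟧+⟦not⟧ false = refl

⟦⟧<⟦⟧ : ∀ {a b} → ⟦ a ⟧ < ⟦ b ⟧ → a ≡ false × b ≡ true
⟦⟧<⟦⟧ {false} {true} _ = refl , refl
⟦⟧<⟦⟧ {true}  {true} (s≤s ())

count-mono : ∀ {n} {p q : Fin n → Bool} → (∀ v → p v ≡ true → q v ≡ true) → count p ≤ count q
count-mono h = size-mono (λ v → ⟦⟧-mono (h v))

count-≤ : ∀ {n} (p : Fin n → Bool) → count p ≤ n
count-≤ {n} p = ≤-trans (size-mono (λ v → ⟦⟧≤1 (p v))) (≤-reflexive (size-1 {n}))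

count-∨ : ∀ {n} (p q : Fin n → Bool) → count (λ v → p v ∨ q v) ≤ count p + count q
count-∨ p q = ≤-trans (size-mono (λ v → ⟦∨⟧ (p v) (q v))) (≤-reflexive (size-+ (λ v → ⟦ p v ⟧) (λ v → ⟦ q v ⟧)))

count-not : ∀ {n} (p : Fin n → Bool) → count p + count (not ∘ p) ≡ n
count-not {n} p = trans (sym (size-+ (λ v → ⟦ p v ⟧) (λ v → ⟦ not (p v) ⟧)))
  (trans (size-cong (λ v → ⟦⟧+⟦not⟧ (p v))) (size-1 {n}))

count-< : ∀ {n} {p q : Fin n → Bool} → count p < count q → ∃ λ v → p v ≡ false × q v ≡ true
count-< p<q with size-< p<q
... | v , lt = v , ⟦⟧<⟦⟧ lt

count-∈ : ∀ {n} (p : Fin n → Bool) {v} → p v ≡ true → 1 ≤ count p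
count-∈ p {v} pv = ≤-trans (≤-reflexive (cong ⟦_⟧ (sym pv))) (≤-size (λ v → ⟦ p v ⟧) v)

not-false : ∀ {b} → not b ≡ false → b ≡ true
not-false {true} _ = refl

not-true : ∀ {b} → not b ≡ true → b ≡ false
not-true {false} _ = refl

count-overlap : ∀ {n} (p q : Fin n → Bool) → n < count p + count q → ∃ λ v → p v ≡ true × q v ≡ true
count-overlap {n} p q n<p+q with count-< {p = not ∘ q} {p} (+-cancelʳ-< (count q) _ _ bound)
  where
  bound : count (not ∘ q) + count q < count p + count q
  bound = subst (_< count p + count q) (trans (sym (count-not q)) (+-comm (count q) _)) n<p+q
... | v , ¬qv , pv = v , pv , not-false ¬qv

∨-introˡ : ∀ {a b} → a ≡ true → a ∨ b ≡ true
∨-introˡ refl = refl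

∨-introʳ : ∀ {a b} → b ≡ true → a ∨ b ≡ true
∨-introʳ {true}  _ = refl
∨-introʳ {false} p = p

∨-elim : ∀ {a b} → a ∨ b ≡ true → a ≡ true ⊎ b ≡ true
∨-elim {true}  _ = inj₁ refl
∨-elim {false} p = inj₂ p

∨-false : ∀ {a b} → a ∨ b ≡ false → a ≡ false × b ≡ false
∨-false {false} p = refl , p

∧-elim : ∀ {a b} → a ∧ b ≡ true → a ≡ true × b ≡ true
∧-elim {true} p = refl , p

∧-intro : ∀ {a b} → a ≡ true → b ≡ true → a ∧ b ≡ true
∧-intro refl refl = refl

true≢false : ∀ {b} → b ≡ true → b ≡ false → ⊥
true≢false refl ()

_==_ : ∀ {n} → Fin n → Fin n → Bool
a == b = does (a F.≟ b)

==-sound : ∀ {n} {a b : Fin n} → a == b ≡ true → a ≡ b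
==-sound {a = a} {b} p with a F.≟ b
... | yes a≡b = a≡b

==-refl : ∀ {n} (a : Fin n) → a == a ≡ true
==-refl a with a F.≟ a
... | yes _  = refl
... | no a≢a = contradiction refl a≢a

anyᶠ : ∀ {n} → (Fin n → Bool) → Bool
anyᶠ {zero}  p = false
anyᶠ {suc n} p = p F.zero ∨ anyᶠ (p ∘ F.suc)

anyᶠ-intro : ∀ {n} (p : Fin n → Bool) i → p i ≡ true → anyᶠ p ≡ true
anyᶠ-intro p F.zero    pi = ∨-introˡ pi
anyᶠ-intro p (F.suc i) pi = ∨-introʳ {p F.zero} (anyᶠ-intro (p ∘ F.suc) i pi)

anyᶠ-elim : ∀ {n} (p : Fin n → Bool) → anyᶠ p ≡ true → ∃ λ i → p i ≡ true
anyᶠ-elim {suc n} p h with ∨-elim {p F.zero} h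
... | inj₁ p0 = F.zero , p0
... | inj₂ ps with anyᶠ-elim (p ∘ F.suc) ps
... | i , pi = F.suc i , pi

anyᶠ-≤ : ∀ {n} (p : Fin n → Bool) → ⟦ anyᶠ p ⟧ ≤ count p
anyᶠ-≤ {zero}  p = z≤n
anyᶠ-≤ {suc n} p = ≤-trans (⟦∨⟧ (p F.zero) _) (+-monoʳ-≤ ⟦ p F.zero ⟧ (anyᶠ-≤ (p ∘ F.suc)))

Matrix : ℕ → Set
Matrix n = Fin n → Fin n → Bool

nbrs : ∀ {n} → Matrix n → (Fin n → Bool) → Fin n → Bool
nbrs adj A v = anyᶠ (λ u → A u ∧ adj u v)

nbrs-intro : ∀ {n} (adj : Matrix n) A {u v} → A u ≡ true → adj u v ≡ true → nbrs adj A v ≡ true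
nbrs-intro adj A {u} {v} Au uv = anyᶠ-intro (λ u → A u ∧ adj u v) u (∧-intro Au uv)

nbrs-elim : ∀ {n} (adj : Matrix n) A {v} → nbrs adj A v ≡ true → ∃ λ u → A u ≡ true × adj u v ≡ true
nbrs-elim adj A {v} h with anyᶠ-elim (λ u → A u ∧ adj u v) h
... | u , p = u , ∧-elim p

ball : ∀ {n} → Matrix n → Fin n → ℕ → Fin n → Bool
ball adj a zero    v = v == a
ball adj a (suc k) v = ball adj a k v ∨ nbrs adj (ball adj a k) v

-- Walks of length at most k: wait pads a shorter walk.
data Within {n} (adj : Matrix n) : ℕ → Fin n → Fin n → Set where
  here : ∀ {a} → Within adj 0 a a
  wait : ∀ {k a b} → Within adj k a b → Within adj (suc k) a b
  snoc : ∀ {k a b c} → Within adj k a b → adj b c ≡ true → Within adj (suc k) a c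

Symmetric : ∀ {n} → Matrix n → Set
Symmetric adj = ∀ u v → adj u v ≡ true → adj v u ≡ true

module _ {n} {adj : Matrix n} where

  concat : ∀ {j k a b c} → Within adj j a b → Within adj k b c → Within adj (k + j) a c
  concat w here       = w
  concat w (wait w′)   = wait (concat w w′)
  concat w (snoc w′ e) = snoc (concat w w′) e

  cons : ∀ {k a b c} → adj a b ≡ true → Within adj k b c → Within adj (suc k) a c
  cons e here        = snoc here e
  cons e (wait w)    = wait (cons e w)
  cons e (snoc w e′) = snoc (cons e w) e′

  reverse : Symmetric adj → ∀ {k a b} → Within adj k a b → Within adj k b a
  reverse sym-adj here       = here
  reverse sym-adj (wait w)   = wait (reverse sym-adj w)
  reverse sym-adj (snoc w e) = cons (sym-adj _ _ e) (reverse sym-adj w)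

  weaken : ∀ {j k a b} → j ≤ k → Within adj j a b → Within adj k a b
  weaken {k = zero}  z≤n     w          = w
  weaken {k = suc k} z≤n     w          = wait (weaken z≤n w)
  weaken             (s≤s h) (wait w)   = wait (weaken h w)
  weaken             (s≤s h) (snoc w e) = snoc (weaken h w) e

  ball-sound : ∀ k {a v} → ball adj a k v ≡ true → Within adj k a v
  ball-sound zero    {a} {v} p with ==-sound {a = v} {a} p
  ... | refl = here
  ball-sound (suc k) {a} {v} p with ∨-elim {ball adj a k v} p
  ... | inj₁ q = wait (ball-sound k q)
  ... | inj₂ q with nbrs-elim adj (ball adj a k) q
  ... | u , bu , e = snoc (ball-sound k bu) e

  ball-complete : ∀ {k a v} → Within adj k a v → ball adj a k v ≡ true
  ball-complete {a = a} here = ==-refl a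
  ball-complete (wait w) = ∨-introˡ (ball-complete w)
  ball-complete {suc k} {a} {v} (snoc w e) =
    ∨-introʳ {ball adj a k v} (nbrs-intro adj (ball adj a k) (ball-complete w) e)

-- `T` is free, rather than the neighbourhood of `A`, so that empty and already used vertices can be
-- put into it, and so that a failure is a pair `(A , T)` as counted by the union bound. If `T`
-- contains the whole neighbourhood of a nonempty `A`, the edge cannot exist, so one of the two
-- bounds on `count T` must fail.
Expands : ∀ {n} → Matrix n → ℕ → ℕ → Set
Expands {n} adj K h = (A T : Fin n → Bool) →
  1 ≤ count A → count T ≤ K * count A → count T + h ≤ n →
  ∃ λ u → ∃ λ v → A u ≡ true × T v ≡ false × adj u v ≡ true

ball-1≤ : ∀ {n} (adj : Matrix n) a k → 1 ≤ count (ball adj a k)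
ball-1≤ adj a k = count-∈ (ball adj a k) (ball-complete {k = k} {a} {a} (weaken z≤n here))

-- Pebbling

move-other : ∀ {n} (C : Config n) u v x → x ≢ u → C x ≤ move C u v x
move-other C u v x x≢u rewrite [≡?]-≢ x≢u = m≤m+n (C x) _

move-source : ∀ {n} (C : Config n) u v → C u ∸ 2 ≤ move C u v u
move-source C u v rewrite [≡?]-refl u = m≤m+n (C u ∸ 2) _

move-target : ∀ {n} (C : Config n) u v → v ≢ u → suc (C v) ≤ move C u v v
move-target C u v v≢u rewrite [≡?]-≢ v≢u | [≡?]-refl v = ≤-reflexive (+-comm 1 (C v))

module _ {n} (G : Graph n) where

  adj-≢ : ∀ {u v} → Adj G u v → v ≢ u
  adj-≢ uv refl = irrefl G uv

  push : ∀ {u v} → Adj G u v → ∀ j C → 2 * j ≤ C u → ∃ λ D → Star (Step G) C D × j + C v ≤ D v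
  push uv zero    C _ = C , ε , ≤-refl
  push {u} {v} uv (suc j) C h
    with push uv j (move C u v) (≤-trans left (move-source C u v))
    where
    left : 2 * j ≤ C u ∸ 2
    left = subst (_≤ C u ∸ 2) (cong (_∸ 2) (*-suc 2 j)) (∸-monoˡ-≤ 2 h)
  ... | D , steps , le = D , step u v uv (≤-trans (*-monoʳ-≤ 2 (s≤s z≤n)) h) ◅ steps ,
    ≤-trans (≤-reflexive (sym (+-suc j (C v))))
      (≤-trans (+-monoʳ-≤ j (move-target C u v (adj-≢ uv))) le)

  -- `F` is the footprint: the only vertices whose pebbles the delivery may spend. Quantifying over
  -- every `C′` that dominates `C` on `F` alone lets deliveries with disjoint footprints run one
  -- after another. Two pebbles at `v`, not one, since two allow a further step.
  Deliver : Config n → (Fin n → Set) → Fin n → Set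
  Deliver C F v = ∀ C′ → (∀ x → F x → C x ≤ C′ x) →
    ∃ λ D → Star (Step G) C′ D × 2 ≤ D v × (∀ x → ¬ F x → C′ x ≤ D x)

  module _ {C : Config n} where

    deliver-start : ∀ {F : Fin n → Set} {v} → F v → 2 ≤ C v → Deliver C F v
    deliver-start Fv 2≤Cv C′ C≤ = C′ , ε , ≤-trans 2≤Cv (C≤ _ Fv) , λ _ _ → ≤-refl

    deliver-mono : ∀ {F F′ : Fin n → Set} {v} → (∀ x → F x → F′ x) → Deliver C F v → Deliver C F′ v
    deliver-mono F⊆F′ del C′ C≤ with del C′ (λ x Fx → C≤ x (F⊆F′ x Fx))
    ... | D , steps , 2≤ , keep = D , steps , 2≤ , λ x ¬F′x → keep x (¬F′x ∘ F⊆F′ x)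

    -- This is the free transport: `v` lies outside the old footprint, so its own pebble is still
    -- there when one arrives from `u`, and together they make two again.
    deliver-extend : ∀ {F F′ : Fin n → Set} {u v} → Adj G u v → 1 ≤ C v →
      F u → ¬ F v → (∀ x → F x → F′ x) → F′ v → Deliver C F u → Deliver C F′ v
    deliver-extend {u = u} {v} uv 1≤Cv Fu ¬Fv F⊆F′ F′v del C′ C≤
      with del C′ (λ x Fx → C≤ x (F⊆F′ x Fx))
    ... | D , steps , 2≤ , keep = move D u v , steps ◅◅ (step u v uv 2≤ ◅ ε) ,
      ≤-trans (s≤s (≤-trans 1≤Cv (≤-trans (C≤ v F′v) (keep v ¬Fv)))) (move-target D u v (adj-≢ uv)) ,
      λ x ¬F′x → ≤-trans (keep x (¬F′x ∘ F⊆F′ x))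
        (move-other D u v x (λ { refl → ¬F′x (F⊆F′ x Fu) }))

    deliver-to : ∀ {F : Fin n → Set} {u v} → Adj G u v → F u → ¬ F v → Deliver C F u →
      ∀ C′ → (∀ x → F x → C x ≤ C′ x) →
      ∃ λ D → Star (Step G) C′ D × suc (C′ v) ≤ D v × (∀ x → ¬ F x → C′ x ≤ D x)
    deliver-to {u = u} {v} uv Fu ¬Fv del C′ C≤ with del C′ C≤
    ... | D , steps , 2≤ , keep = move D u v , steps ◅◅ (step u v uv 2≤ ◅ ε) ,
      ≤-trans (s≤s (keep v ¬Fv)) (move-target D u v (adj-≢ uv)) ,
      λ x ¬Fx → ≤-trans (keep x ¬Fx) (move-other D u v x (λ { refl → ¬Fx Fu }))

    -- The label classes below `s` are disjoint footprints: the delivery from class `k` needs only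
    -- that class intact, and the earlier ones touched only smaller labels. The label of `w` is at
    -- least `s`, so `w` is outside every footprint and keeps what it has collected.
    gather : ∀ (ℓ : Fin n → ℕ) s {w} → s ≤ ℓ w →
      (∀ i → i < s → ∃ λ u → ℓ u ≡ i × Adj G u w × Deliver C (λ x → ℓ x ≡ i) u) →
      ∀ k → k ≤ s → ∃ λ D → Star (Step G) C D × k ≤ D w × (∀ x → k ≤ ℓ x → C x ≤ D x)
    gather ℓ s s≤ℓw src zero    _ = C , ε , z≤n , λ _ _ → ≤-refl
    gather ℓ s {w} s≤ℓw src (suc k) k<s with gather ℓ s s≤ℓw src k (<⇒≤ k<s) | src k k<s
    ... | D , steps , k≤ , keep | u , ℓu , uw , del
      with deliver-to uw ℓu (λ ℓw → <⇒≢ (<-≤-trans k<s s≤ℓw) (sym ℓw)) del D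
             (λ x ℓx → keep x (≤-reflexive (sym ℓx)))
    ... | D′ , steps′ , w≤ , keep′ = D′ , steps ◅◅ steps′ , ≤-trans (s≤s k≤) w≤ ,
      λ x k<ℓx → ≤-trans (keep x (<⇒≤ k<ℓx)) (keep′ x (λ ℓx → <⇒≢ k<ℓx (sym ℓx)))

graph : ∀ {n} (adj : Matrix n) → Symmetric adj → (∀ u → adj u u ≡ false) → Graph n
graph adj sym-adj loopless = record
  { Adj = λ u v → adj u v ≡ true
  ; sym = λ {u} {v} → sym-adj u v
  ; irrefl = λ {u} uu → true≢false uu (loopless u)
  }

solvable-≥ : ∀ {n} {G : Graph n} {C D : Config n} {r} → Star (Step G) C D → RSolvable G D r → RSolvable G C r
solvable-≥ steps (E , steps′ , 1≤) = E , steps ◅◅ steps′ , 1≤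

isZero isBig : ℕ → Bool
isZero zero    = true
isZero (suc _) = false
isBig (suc (suc _)) = true
isBig _             = false

isZero-false : ∀ {c} → isZero c ≡ false → 1 ≤ c
isZero-false {suc c} _ = s≤s z≤n

isBig-true : ∀ {c} → isBig c ≡ true → 2 ≤ c
isBig-true {suc (suc c)} _ = s≤s (s≤s z≤n)

-- Summed over the vertices of a configuration of n pebbles, the two sides become n + z and n + s ·
-- b, with z empty vertices and b vertices holding at least two pebbles.
zero-big-bound : ∀ {s} c → c ≤ s → c + ⟦ isZero c ⟧ ≤ 1 + s * ⟦ isBig c ⟧
zero-big-bound zero          _   = s≤s z≤n
zero-big-bound (suc zero)    _   = s≤s z≤n
zero-big-bound {s} (suc (suc c)) c≤s =
  ≤-trans (≤-reflexive (+-identityʳ _)) (≤-trans c≤s (≤-trans (≤-reflexive (sym (*-identityʳ s))) (n≤1+n _)))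

module _ {n} (adj : Matrix n) (sym-adj : Symmetric adj) (loopless : ∀ u → adj u u ≡ false) where

  private
    G : Graph n
    G = graph adj sym-adj loopless

  -- The number `j` varies in the induction, since the last edge of the walk needs `2 * j` pebbles
  -- at its start.
  walk-solvable : ∀ {k a r} → Within adj k a r → ∀ j C → 2 ^ k * j ≤ C a → ∃ λ D → Star (Step G) C D × j ≤ D r
  walk-solvable here       j C h = C , ε , ≤-trans (≤-reflexive (sym (+-identityʳ j))) h
  walk-solvable (wait {k} w)   j C h =
    walk-solvable w j C (≤-trans (*-monoˡ-≤ j (m≤m+n (2 ^ k) _)) h)
  walk-solvable (snoc {k} w e) j C h
    with walk-solvable w (2 * j) C (≤-trans (≤-reflexive (assoc (2 ^ k) j)) h)
    where
    assoc : ∀ p j → p * (2 * j) ≡ 2 * p * j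
    assoc = solve-∀
  ... | D , steps , le with push G e j D le
  ... | D′ , steps′ , le′ = D′ , steps ◅◅ steps′ , ≤-trans (m≤m+n j _) le′

  module _ {K h} (ex : Expands adj K h) (1≤h : 1 ≤ h) where

    -- No edge from the ball of radius `k` leaves the ball of radius `suc k`. With these two as `A`
    -- and `T`, `Expands` therefore forbids growth by a factor of at most `K` until fewer than `h`
    -- vertices are missing.
    ball-grows : ∀ a k → K ^ k ≤ count (ball adj a k) ⊎ n < count (ball adj a k) + h
    ball-grows a zero = inj₁ (ball-1≤ adj a 0)
    ball-grows a (suc k) with count (ball adj a (suc k)) + h ≤? n
    ... | no  big   = inj₂ (≰⇒> big)
    ... | yes small with count (ball adj a (suc k)) ≤? K * count (ball adj a k)
    ... | yes slow with ex (ball adj a k) (ball adj a (suc k)) (ball-1≤ adj a k) slow small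
    ... | u , v , Au , ¬Tv , uv =
      ⊥-elim (true≢false (∨-introʳ {ball adj a k v} (nbrs-intro adj (ball adj a k) Au uv)) ¬Tv)
    ball-grows a (suc k) | yes small | no fast with ball-grows a k
    ... | inj₁ le = inj₁ (≤-trans (*-monoʳ-≤ K le) (<⇒≤ (≰⇒> fast)))
    ... | inj₂ lt = contradiction (≤-trans (+-monoˡ-≤ h (count-mono {p = ball adj a k} {ball adj a (suc k)} (λ v → ∨-introˡ))) small) (<⇒≱ lt)

    -- Both balls of radius `t` miss fewer than `h` vertices, and `2 * h ≤ n` makes them meet. This
    -- is the source of the exponent in `s ≡ 2 ^ (t + t)`.
    diameter : ∀ {t} → n ≤ K ^ t → 2 * h ≤ n → ∀ w r → Within adj (t + t) w r
    diameter {t} n≤K^t 2h≤n w r with count-overlap (ball adj w t) (ball adj r t) both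
      where
      large : ∀ a → n < count (ball adj a t) + h
      large a with ball-grows a t
      ... | inj₂ lt = lt
      ... | inj₁ le = ≤-trans (≤-reflexive (+-comm 1 n)) (+-mono-≤ (≤-trans n≤K^t le) 1≤h)
      regroup : ∀ a b h → (a + h) + (b + h) ≡ (a + b) + 2 * h
      regroup = solve-∀
      both : n < count (ball adj w t) + count (ball adj r t)
      both = +-cancelʳ-< (2 * h) _ _ (begin-strict
        n + 2 * h ≤⟨ +-monoʳ-≤ n 2h≤n ⟩
        n + n <⟨ +-mono-< (large w) (large r) ⟩
        (count (ball adj w t) + h) + (count (ball adj r t) + h) ≡⟨ regroup (count (ball adj w t)) (count (ball adj r t)) h ⟩
        (count (ball adj w t) + count (ball adj r t)) + 2 * h ∎)
        where open ≤-Reasoning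
    ... | x , wx , rx = concat (ball-sound t wx) (reverse sym-adj (ball-sound t rx))

-- Expansion implies solvability

does-true : ∀ {P : Set} (d : Dec P) → does d ≡ true → P
does-true (yes p) _ = p

does-false : ∀ {P : Set} (d : Dec P) → does d ≡ false → ¬ P
does-false (no ¬p) _ = ¬p

[≡?]≡⟦==⟧ : ∀ {n} (a b : Fin n) → [ a ≡? b ] ≡ ⟦ a == b ⟧
[≡?]≡⟦==⟧ a b with a F.≟ b
... | yes _ = refl
... | no _  = refl

insert : ∀ {n} → (Fin n → Bool) → Fin n → Fin n → Bool
insert A v x = A x ∨ (x == v)

count-insert : ∀ {n} (A : Fin n → Bool) v → A v ≡ false → suc (count A) ≤ count (insert A v)
count-insert A v Av = begin
  suc (count A)                          ≡⟨ +-comm 1 _ ⟩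
  count A + 1                            ≡⟨ cong (count A +_) (size-[≡?] v) ⟨
  count A + size (λ x → [ x ≡? v ])      ≡⟨ size-+ (λ x → ⟦ A x ⟧) (λ x → [ x ≡? v ]) ⟨
  size (λ x → ⟦ A x ⟧ + [ x ≡? v ])      ≤⟨ size-mono pointwise ⟩
  count (insert A v)                     ∎
  where
  open ≤-Reasoning
  pointwise : ∀ x → ⟦ A x ⟧ + [ x ≡? v ] ≤ ⟦ A x ∨ (x == v) ⟧
  pointwise x with x F.≟ v
  ... | yes refl rewrite Av = ≤-refl
  ... | no _ with A x
  ... | true  = ≤-refl
  ... | false = ≤-refl

relabel : ∀ {n} → (Fin n → ℕ) → Fin n → ℕ → Fin n → ℕ
relabel ℓ v i x = if x == v then i else ℓ x

relabel-≡ : ∀ {n} (ℓ : Fin n → ℕ) v i → relabel ℓ v i v ≡ i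
relabel-≡ ℓ v i rewrite ==-refl v = refl

-- `q` is n / K rounded down. For groups of size m ≤ q the bound K · m ≤ n keeps the set to be
-- avoided within the range of expansion; at size q + 1 the product with K reaches n, so a group is
-- adjacent to all but at most `h` vertices.
module Solve {n} (adj : Matrix n) (sym-adj : Symmetric adj) (loopless : ∀ u → adj u u ≡ false)
  (K h t s q : ℕ) (ex : Expands adj K h) (1≤h : 1 ≤ h)
  (s≡ : s ≡ 2 ^ (t + t)) (K≡ : K ≡ 8 * (s * s)) (n≤K^t : n ≤ K ^ t)
  (4sh≤n : 4 * (s * h) ≤ n) (K≤n : K ≤ n) (Kq≤n : K * q ≤ n) (n≤Kq : n ≤ K * suc q) where

  G : Graph n
  G = graph adj sym-adj loopless

  1≤s : 1 ≤ s
  1≤s = subst (1 ≤_) (sym s≡) (m^n>0 2 (t + t))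

  4h≤n : 4 * h ≤ n
  4h≤n = ≤-trans (*-monoʳ-≤ 4 (≤-trans (≤-reflexive (sym (*-identityˡ h))) (*-monoˡ-≤ h 1≤s))) 4sh≤n

  2h≤n : 2 * h ≤ n
  2h≤n = ≤-trans (*-monoˡ-≤ h {2} {4} (s≤s (s≤s z≤n))) 4h≤n

  1≤ss : 1 ≤ s * s
  1≤ss = *-mono-≤ 1≤s 1≤s

  module _ (C : Config n) (size≡n : size C ≡ n) (r : Fin n) where

    accumulated : ∀ D w → s ≤ D w → RSolvable G D r
    accumulated D w s≤Dw = walk-solvable adj sym-adj loopless
      (diameter adj sym-adj loopless ex 1≤h {t} n≤K^t 2h≤n w r) 1 D
      (≤-trans (≤-reflexive (trans (*-identityʳ _) (sym s≡))) s≤Dw)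

    zeros bigs : Fin n → Bool
    zeros v = isZero (C v)
    bigs  v = isBig (C v)

    zeros≤bigs : (∀ v → C v ≤ s) → count zeros ≤ s * count bigs
    zeros≤bigs C≤s = +-cancelˡ-≤ n _ _ (begin
      n + count zeros                          ≡⟨ cong (_+ count zeros) size≡n ⟨
      size C + count zeros                     ≡⟨ size-+ C (λ v → ⟦ zeros v ⟧) ⟨
      size (λ v → C v + ⟦ zeros v ⟧)           ≤⟨ size-mono (λ v → zero-big-bound (C v) (C≤s v)) ⟩
      size (λ v → 1 + s * ⟦ bigs v ⟧)          ≡⟨ size-+ (λ _ → 1) (λ v → s * ⟦ bigs v ⟧) ⟩
      size {n} (λ _ → 1) + size (λ v → s * ⟦ bigs v ⟧)
        ≡⟨ cong₂ _+_ (size-1 {n}) (size-* s (λ v → ⟦ bigs v ⟧)) ⟩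
      n + s * count bigs                       ∎)
      where open ≤-Reasoning

    module Few (z≤ss : count zeros ≤ s * s) (Cr≡0 : C r ≡ 0) where

      z = count zeros

      -- The empty vertices number at most s², so adding all of them to a nonempty set still stays
      -- within the factor K. It serves both for the reached set and, in the opposite direction, for
      -- the unreached one.
      sparse : ∀ {a b} → a ≤ b + z → 1 ≤ b → a ≤ K * b
      sparse {a} {b} a≤ 1≤b = begin
        a              ≤⟨ a≤ ⟩
        b + z          ≤⟨ +-monoʳ-≤ b (≤-trans (≤-reflexive (sym (*-identityʳ z))) (*-monoʳ-≤ z 1≤b)) ⟩
        suc z * b      ≤⟨ *-monoˡ-≤ b (+-mono-≤ 1≤ss z≤ss) ⟩
        (s * s + s * s) * b ≤⟨ *-monoˡ-≤ b (+-monoʳ-≤ (s * s) (m≤m+n (s * s) _)) ⟩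
        8 * (s * s) * b ≡⟨ cong (_* b) K≡ ⟨
        K * b          ∎
        where open ≤-Reasoning

      -- When the reached set together with the empty vertices comes within `h` of n, fewer than z +
      -- h vertices are unreached; a further `h` must fit for expansion to apply with the unreached
      -- vertices as `T`.
      z+2h≤n : z + 2 * h ≤ n
      z+2h≤n = *-cancelˡ-≤ 2 (begin
        2 * (z + 2 * h)          ≡⟨ regroup z h ⟩
        2 * z + 4 * h            ≤⟨ +-mono-≤ (*-mono-≤ {2} {8} (s≤s (s≤s z≤n)) z≤ss) 4h≤n ⟩
        8 * (s * s) + n          ≡⟨ cong (_+ n) K≡ ⟨
        K + n                    ≤⟨ +-monoˡ-≤ n K≤n ⟩
        n + n                    ≡⟨ cong (n +_) (+-identityʳ n) ⟨
        2 * n                    ∎)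
        where
        open ≤-Reasoning
        regroup : ∀ z h → 2 * (z + 2 * h) ≡ 2 * z + 4 * h
        regroup = solve-∀

      -- The footprint is all of `A` rather than a path inside it. This is harmless because only one
      -- delivery, the last, is carried out.
      Served : (Fin n → Bool) → Set
      Served A = ∀ v → A v ≡ true → 1 ≤ C v × Deliver G C (λ x → A x ≡ true) v

      served-insert : ∀ {A u v} → Served A → A u ≡ true → A v ≡ false → adj u v ≡ true → 1 ≤ C v →
        Served (insert A v)
      served-insert {A} {u} {v} serve Au Av uv 1≤Cv x A′x with x F.≟ v
      ... | yes refl = 1≤Cv , deliver-extend G uv 1≤Cv Au (λ Av′ → true≢false Av′ Av)
                         (λ y → ∨-introˡ) (∨-introʳ {A v} (==-refl v)) (proj₂ (serve u Au))
      ... | no _ with ∨-elim {A x} A′x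
      ... | inj₁ Ax = proj₁ (serve x Ax) , deliver-mono G (λ y → ∨-introˡ) (proj₂ (serve x Ax))

      r∉ : ∀ {A} → Served A → A r ≡ true → ⊥
      r∉ serve Ar with subst (1 ≤_) Cr≡0 (proj₁ (serve r Ar))
      ... | ()

      data Progress (A : Fin n → Bool) : Set where
        solved : RSolvable G C r → Progress A
        extend : ∀ {u v} → A u ≡ true → A v ≡ false → adj u v ≡ true → 1 ≤ C v → Progress A

      -- If A is too large for its own expansion to apply, it misses few vertices, and the
      -- expansion of R, the unreached occupied vertices and the root, gives an edge into A.
      progress : ∀ A → Served A → 1 ≤ count A → Progress A
      progress A serve 1≤A with count (λ v → A v ∨ zeros v) + h ≤? n
      ... | yes small with ex A (λ v → A v ∨ zeros v) 1≤A (sparse (count-∨ A zeros) 1≤A) small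
      ... | u , v , Au , ¬v , uv with ∨-false {A v} ¬v
      ... | ¬Av , ¬Zv = extend Au ¬Av uv (isZero-false ¬Zv)
      progress A serve 1≤A | no big with ex R (not ∘ A) 1≤R (sparse T≤ 1≤R) T+h≤n
        where
        R : Fin n → Bool
        R = insert (λ v → not (A v ∨ zeros v)) r
        1≤R : 1 ≤ count R
        1≤R = count-∈ R (∨-introʳ {not (A r ∨ zeros r)} (==-refl r))
        T⊆ : ∀ v → not (A v) ≡ true → R v ∨ zeros v ≡ true
        T⊆ v ¬Av with A v | zeros v
        ... | false | true  = ∨-introʳ {false ∨ (v == r)} refl
        ... | false | false = refl
        T≤ : count (not ∘ A) ≤ count R + z
        T≤ = ≤-trans (count-mono {p = not ∘ A} {λ v → R v ∨ zeros v} T⊆) (count-∨ R zeros)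
        open ≤-Reasoning
        regroup : ∀ z h → (z + h) + h ≡ z + 2 * h
        regroup = solve-∀
        T≤z+h : count (not ∘ A) ≤ z + h
        T≤z+h = <⇒≤ (+-cancelˡ-< (count A) _ _ (begin-strict
          count A + count (not ∘ A)            ≡⟨ count-not A ⟩
          n                                    <⟨ ≰⇒> big ⟩
          count (λ v → A v ∨ zeros v) + h      ≤⟨ +-monoˡ-≤ h (count-∨ A zeros) ⟩
          (count A + z) + h                    ≡⟨ +-assoc (count A) z h ⟩
          count A + (z + h)                    ∎))
        T+h≤n : count (not ∘ A) + h ≤ n
        T+h≤n = ≤-trans (+-monoˡ-≤ h T≤z+h) (≤-trans (≤-reflexive (regroup z h)) z+2h≤n)
      ... | u , v , Ru , ¬¬Av , uv with A v in Av
      ... | true with ∨-elim {not (A u ∨ zeros u)} Ru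
      ... | inj₂ u==r with ==-sound {a = u} {r} u==r
      ... | refl with deliver-to G (sym-adj u v uv) Av (r∉ serve) (proj₂ (serve v Av)) C (λ _ _ → ≤-refl)
      ... | D , steps , le , _ = solved (D , steps , ≤-trans (s≤s z≤n) le)
      progress A serve 1≤A | no big | u , v , Ru , ¬¬Av , uv | true | inj₁ ¬u with A u in Au | zeros u in Zu
      ... | false | false = extend Av Au (sym-adj u v uv) (isZero-false Zu)

      -- `k` is fuel: every extension adds a vertex to `A`, and fuel 0 would mean that `A` has more
      -- than n vertices.
      reach : ∀ k A → n < count A + k → Served A → 1 ≤ count A → RSolvable G C r
      reach zero A n<A serve 1≤A = contradiction (count-≤ A) (<⇒≱ (subst (n <_) (+-identityʳ _) n<A))
      reach (suc k) A n<A serve 1≤A with progress A serve 1≤A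
      ... | solved sol = sol
      ... | extend {u} {v} Au Av uv 1≤Cv = reach k (insert A v)
        (≤-trans (subst (n <_) (+-suc (count A) k) n<A) (+-monoˡ-≤ k (count-insert A v Av)))
        (served-insert serve Au Av uv 1≤Cv)
        (≤-trans 1≤A (≤-trans (n≤1+n _) (count-insert A v Av)))

      few-solvable : ∀ u → 2 ≤ C u → RSolvable G C r
      few-solvable u 2≤Cu = reach n (_== u) (subst (n <_) (cong (_+ n) (sym one)) ≤-refl) serve (≤-reflexive (sym one))
        where
        one : count (_== u) ≡ 1
        one = trans (size-cong (λ v → sym ([≡?]≡⟦==⟧ v u))) (size-[≡?] u)
        serve : Served (_== u)
        serve v v==u with ==-sound {a = v} {u} v==u
        ... | refl = ≤-trans (s≤s z≤n) 2≤Cu , deliver-start G v==u 2≤Cu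

    module Many (z≤sb : count zeros ≤ s * count bigs) (s≤b : s ≤ count bigs) where

      group : (Fin n → ℕ) → ℕ → Fin n → Bool
      group ℓ i x = does (ℓ x ≟ i)

      labelled : (Fin n → ℕ) → Fin n → Bool
      labelled ℓ x = does (ℓ x <? s)

      -- Labels ≥ s mean "in no group"; i counts the groups already enlarged in this round.
      record Groups (m i : ℕ) : Set where
        field
          ℓ        : Fin n → ℕ
          delivers : ∀ x → ℓ x < s → Deliver G C (λ y → ℓ y ≡ ℓ x) x
          total    : count (labelled ℓ) ≤ s * m + i
          low      : ∀ j → j < s → m ≤ count (group ℓ j)
          done     : ∀ j → j < i → suc m ≤ count (group ℓ j)

      module _ {m i} (i<s : i < s) (m≤q : m ≤ q) (gs : Groups m i) where
        open Groups gs

        module Add (v : Fin n) (free : ¬ ℓ v < s) where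
          ℓ′ : Fin n → ℕ
          ℓ′ = relabel ℓ v i

          keeps : ∀ {x j} → j < s → ℓ x ≡ j → ℓ′ x ≡ j
          keeps {x} j<s ℓx≡j with x F.≟ v
          ... | yes refl = contradiction (subst (_< s) (sym ℓx≡j) j<s) free
          ... | no _     = ℓx≡j

          add : Deliver G C (λ y → ℓ′ y ≡ i) v → Groups m (suc i)
          add del = record
            { ℓ = ℓ′ ; delivers = delivers′ ; total = total′
            ; low = λ j j<s → ≤-trans (low j j<s) (group-mono j j<s)
            ; done = done′ }
            where
            open ≤-Reasoning
            delivers′ : ∀ x → ℓ′ x < s → Deliver G C (λ y → ℓ′ y ≡ ℓ′ x) x
            delivers′ x ℓ′x<s with x F.≟ v
            ... | yes refl = del
            ... | no x≢v   = deliver-mono G (λ y → keeps ℓ′x<s) (delivers x ℓ′x<s)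
            lab-pointwise : ∀ x → ⟦ labelled ℓ′ x ⟧ ≤ ⟦ labelled ℓ x ⟧ + [ x ≡? v ]
            lab-pointwise x with x F.≟ v
            ... | yes _ = ≤-trans (⟦⟧≤1 _) (m≤n+m 1 _)
            ... | no _  = m≤m+n _ 0
            total′ : count (labelled ℓ′) ≤ s * m + suc i
            total′ = begin
              count (labelled ℓ′)                                ≤⟨ size-mono lab-pointwise ⟩
              size (λ x → ⟦ labelled ℓ x ⟧ + [ x ≡? v ])         ≡⟨ size-+ (λ x → ⟦ labelled ℓ x ⟧) (λ x → [ x ≡? v ]) ⟩
              count (labelled ℓ) + size (λ x → [ x ≡? v ])       ≡⟨ cong (count (labelled ℓ) +_) (size-[≡?] v) ⟩
              count (labelled ℓ) + 1                             ≤⟨ +-monoˡ-≤ 1 total ⟩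
              (s * m + i) + 1                                    ≡⟨ +-assoc (s * m) i 1 ⟩
              s * m + (i + 1)                                    ≡⟨ cong (s * m +_) (+-comm i 1) ⟩
              s * m + suc i                                      ∎
            group-mono : ∀ j → j < s → count (group ℓ j) ≤ count (group ℓ′ j)
            group-mono j j<s = count-mono {p = group ℓ j} {group ℓ′ j} (λ x p →
              dec-true (ℓ′ x ≟ j) (keeps j<s (does-true (ℓ x ≟ j) p)))
            group-pointwise : ∀ x → ⟦ insert (group ℓ i) v x ⟧ ≤ ⟦ group ℓ′ i x ⟧
            group-pointwise x = ⟦⟧-mono {insert (group ℓ i) v x} (λ p → dec-true (ℓ′ x ≟ i) (which (∨-elim {group ℓ i x} p)))
              where
              which : group ℓ i x ≡ true ⊎ x == v ≡ true → ℓ′ x ≡ i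
              which (inj₁ p) = keeps i<s (does-true (ℓ x ≟ i) p)
              which (inj₂ p) with ==-sound {a = x} {v} p
              ... | refl = relabel-≡ ℓ x i
            done′ : ∀ j → j < suc i → suc m ≤ count (group ℓ′ j)
            done′ j j<1+i with m≤n⇒m<n∨m≡n (≤-pred j<1+i)
            ... | inj₁ j<i  = ≤-trans (done j j<i) (group-mono j (<-trans j<i i<s))
            ... | inj₂ refl = ≤-trans (s≤s (low i i<s)) (≤-trans
              (count-insert (group ℓ i) v (dec-false (ℓ v ≟ i) (λ ℓv≡i → free (subst (_< s) (sym ℓv≡i) i<s))))
              (size-mono group-pointwise))

        labelled< : count (labelled ℓ) < s * suc m
        labelled< = ≤-<-trans total (subst (s * m + i <_) (trans (+-comm (s * m) s) (sym (*-suc s m))) (+-monoʳ-< (s * m) i<s))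

        -- If the vertices with two or more pebbles outnumber the labelled ones, an unlabelled one
        -- joins group `i` directly; groups need not be connected. Otherwise there are fewer than
        -- s(m+1) of them, so the empty vertices number at most s²(m+1) and expansion gets past them
        -- and the labelled ones.
        extend-group : Groups m (suc i)
        extend-group with s * suc m ≤? count bigs
        ... | yes many with count-< {p = labelled ℓ} {bigs} (<-≤-trans labelled< many)
        ... | v , ¬lab , big = Add.add v (does-false (ℓ v <? s) ¬lab)
                (deliver-start G (relabel-≡ ℓ v i) (isBig-true big))
        extend-group | no few
          with ex (group ℓ i) T 1≤A (≤-trans T≤ (≤-trans (m≤m+n (4 * (s * s) * m) _) (≤-trans twice (*-monoʳ-≤ K (low i i<s))))) T+h≤n
          where
          T : Fin n → Bool
          T v = labelled ℓ v ∨ zeros v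
          -- In the round m = 0 the hypothesis `s≤b` already gives the other case; so here m ≥ 1,
          -- the group is nonempty, and suc m ≤ 2m.
          1≤m : 1 ≤ m
          1≤m = n≢0⇒n>0 (λ m≡0 → few (subst (λ j → s * suc j ≤ count bigs) (sym m≡0)
            (subst (_≤ count bigs) (sym (*-identityʳ s)) s≤b)))
          1≤A : 1 ≤ count (group ℓ i)
          1≤A = ≤-trans 1≤m (low i i<s)
          open ≤-Reasoning
          collect : ∀ s m → s * (s * (m + m)) + s * (s * (m + m)) ≡ 4 * (s * s) * m
          collect = solve-∀
          T≤ : count T ≤ 4 * (s * s) * m
          T≤ = begin
            count T                                         ≤⟨ count-∨ (labelled ℓ) zeros ⟩
            count (labelled ℓ) + count zeros                ≤⟨ +-mono-≤ (<⇒≤ labelled<) (≤-trans z≤sb (*-monoʳ-≤ s (<⇒≤ (≰⇒> few)))) ⟩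
            s * suc m + s * (s * suc m)                     ≤⟨ +-monoˡ-≤ _ (≤-trans (≤-reflexive (sym (*-identityˡ _))) (*-monoˡ-≤ (s * suc m) 1≤s)) ⟩
            s * (s * suc m) + s * (s * suc m)               ≤⟨ +-mono-≤ double double ⟩
            s * (s * (m + m)) + s * (s * (m + m))           ≡⟨ collect s m ⟩
            4 * (s * s) * m                                 ∎
            where
            double : s * (s * suc m) ≤ s * (s * (m + m))
            double = *-monoʳ-≤ s (*-monoʳ-≤ s (+-monoˡ-≤ m 1≤m))
          -- Of the 8 in K, the factor 4 bounds `T` and the factor 2 is spare: it makes `T` at most
          -- n / 2, leaving the other half for `h`.
          twice : 2 * (4 * (s * s) * m) ≤ K * m
          twice = ≤-reflexive (trans (halve (s * s) m) (cong (_* m) (sym K≡)))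
            where
            halve : ∀ a m → 2 * (4 * a * m) ≡ 8 * a * m
            halve = solve-∀
          T+h≤n : count T + h ≤ n
          T+h≤n = *-cancelˡ-≤ 2 (begin
            2 * (count T + h)          ≡⟨ *-distribˡ-+ 2 (count T) h ⟩
            2 * count T + 2 * h        ≤⟨ +-mono-≤ (≤-trans (*-monoʳ-≤ 2 T≤) (≤-trans twice (≤-trans (*-monoʳ-≤ K m≤q) Kq≤n))) 2h≤n ⟩
            n + n                      ≡⟨ cong (n +_) (+-identityʳ n) ⟨
            2 * n                      ∎)
        ... | u , v , Au , ¬Tv , uv with ∨-false {labelled ℓ v} ¬Tv
        ... | ¬lab , ¬Zv = Add.add v free
                (deliver-extend G uv (isZero-false ¬Zv) ℓu≡i (λ ℓv≡i → free (subst (_< s) (sym ℓv≡i) i<s))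
                  (λ y → Add.keeps v free i<s) (relabel-≡ ℓ v i)
                  (subst (λ j → Deliver G C (λ y → ℓ y ≡ j) u) ℓu≡i (delivers u (subst (_< s) (sym ℓu≡i) i<s))))
          where
          free : ¬ ℓ v < s
          free = does-false (ℓ v <? s) ¬lab
          ℓu≡i : ℓ u ≡ i
          ℓu≡i = does-true (ℓ u ≟ i) Au

      round : ∀ {m} → m ≤ q → Groups m 0 → ∀ i → i ≤ s → Groups m i
      round m≤q gs zero    _   = gs
      round m≤q gs (suc i) i<s = extend-group i<s m≤q (round m≤q gs i (<⇒≤ i<s))

      next : ∀ {m} → Groups m s → Groups (suc m) 0
      next {m} gs = record
        { ℓ = ℓ ; delivers = delivers
        ; total = ≤-trans total (≤-reflexive (trans (+-comm (s * m) s) (trans (sym (*-suc s m)) (sym (+-identityʳ _)))))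
        ; low = done ; done = λ _ () }
        where open Groups gs

      groups : ∀ m → m ≤ suc q → Groups m 0
      groups zero _ = record
        { ℓ = λ _ → s ; delivers = λ x s<s → contradiction s<s (<-irrefl refl)
        ; total = ≤-trans (size-mono {g = λ _ → 0} none) (≤-trans (≤-reflexive (size-0 {n})) z≤n)
        ; low = λ _ _ → z≤n ; done = λ _ () }
        where
        none : ∀ (x : Fin n) → ⟦ does (s <? s) ⟧ ≤ 0
        none x rewrite dec-false (s <? s) (<-irrefl refl) = ≤-refl
      groups (suc m) m<1+q = next (round (≤-pred m<1+q) (groups m (<⇒≤ m<1+q)) s ≤-refl)

      module _ (gs : Groups (suc q) 0) where
        open Groups gs

        N : ℕ → Fin n → Bool
        N i = nbrs adj (group ℓ i)
        -- It counts the obstacles to `w` being the collecting vertex: being used itself, and each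
        -- group without a neighbour relation to it. The average is below 1, so some vertex has
        -- none.
        bad : Fin n → ℕ
        bad w = ⟦ labelled ℓ w ⟧ + size {s} (λ i → ⟦ not (N (toℕ i) w) ⟧)
        -- With `T` the neighbourhood of the group no edge can escape, and n ≤ K(q+1) settles the
        -- bound by K, so the bound by n - h is the one that fails.
        missed : ∀ i → i < s → count (not ∘ N i) ≤ h
        missed i i<s with count (N i) + h ≤? n
        ... | no big = <⇒≤ (+-cancelˡ-< (count (N i)) _ _ (subst (_< count (N i) + h) (sym (count-not (N i))) (≰⇒> big)))
        ... | yes small with ex (group ℓ i) (N i) (≤-trans (s≤s z≤n) (low i i<s))
                               (≤-trans (count-≤ (N i)) (≤-trans n≤Kq (*-monoʳ-≤ K (low i i<s)))) small
        ... | u , v , Au , ¬Nv , uv = ⊥-elim (true≢false (nbrs-intro adj (group ℓ i) Au uv) ¬Nv)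
        open ≤-Reasoning
        regroup : ∀ s q → 4 * (s * suc q) ≡ 4 * s * q + 4 * s
        regroup = solve-∀
        4s≤K : 4 * s ≤ K
        4s≤K = begin
          4 * s               ≤⟨ *-mono-≤ {4} {8} (s≤s (s≤s (s≤s (s≤s z≤n)))) (≤-trans (≤-reflexive (sym (*-identityʳ s))) (*-monoʳ-≤ s 1≤s)) ⟩
          8 * (s * s)         ≡⟨ K≡ ⟨
          K                   ∎
        bad≤ : size bad ≤ s * suc q + s * h
        bad≤ = begin
          size bad ≡⟨ size-+ (λ w → ⟦ labelled ℓ w ⟧) (λ w → size {s} (λ i → ⟦ not (N (toℕ i) w) ⟧)) ⟩
          count (labelled ℓ) + size (λ w → size {s} (λ i → ⟦ not (N (toℕ i) w) ⟧))
            ≡⟨ cong (count (labelled ℓ) +_) (size-swap (λ w i → ⟦ not (N (toℕ {s} i) w) ⟧)) ⟩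
          count (labelled ℓ) + size {s} (λ i → count (not ∘ N (toℕ i)))
            ≤⟨ +-mono-≤ total (size-mono (λ i → missed (toℕ i) (FP.toℕ<n i))) ⟩
          (s * suc q + 0) + size {s} (λ _ → h)
            ≡⟨ cong₂ _+_ (+-identityʳ (s * suc q)) (size-const {s} h) ⟩
          s * suc q + s * h ∎
        4bad≤ : 4 * size bad ≤ 3 * n
        4bad≤ = begin
          4 * size bad                           ≤⟨ *-monoʳ-≤ 4 bad≤ ⟩
          4 * (s * suc q + s * h)                ≡⟨ *-distribˡ-+ 4 (s * suc q) (s * h) ⟩
          4 * (s * suc q) + 4 * (s * h)          ≡⟨ cong (_+ 4 * (s * h)) (regroup s q) ⟩
          -- One n for each summand: 4sq ≤ Kq ≤ n, 4s ≤ K ≤ n and 4sh ≤ n.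
          (4 * s * q + 4 * s) + 4 * (s * h)      ≤⟨ +-mono-≤ (+-mono-≤ (≤-trans (*-monoˡ-≤ q 4s≤K) Kq≤n) (≤-trans 4s≤K K≤n)) 4sh≤n ⟩
          (n + n) + n                            ≡⟨ three n ⟩
          3 * n                                  ∎
          where
          three : ∀ n → (n + n) + n ≡ 3 * n
          three = solve-∀
        1≤n : 1 ≤ n
        1≤n = ≤-trans 1≤h (≤-trans (m≤m+n h _) 4h≤n)
        bad<n : size bad < size {n} (λ _ → 1)
        bad<n = *-cancelˡ-< 4 _ _ (begin-strict
          4 * size bad       ≤⟨ 4bad≤ ⟩
          3 * n              <⟨ +-monoˡ-< (3 * n) 1≤n ⟩
          4 * n              ≡⟨ cong (4 *_) (size-1 {n}) ⟨
          4 * size {n} (λ _ → 1) ∎)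

        ⟦⟧<1 : ∀ {b} → ⟦ b ⟧ < 1 → b ≡ false
        ⟦⟧<1 {false} _ = refl
        ⟦⟧<1 {true} (s≤s ())

        unlabelled : ∀ {w} → bad w < 1 → s ≤ ℓ w
        unlabelled {w} bad-w<1 = ≮⇒≥ (does-false (ℓ w <? s) (⟦⟧<1 (≤-<-trans (m≤m+n _ _) bad-w<1)))

        adjacent : ∀ {w} → bad w < 1 → ∀ i → i < s → N i w ≡ true
        adjacent {w} bad-w<1 i i<s = not-false (⟦⟧<1 (≤-<-trans
          (subst (λ j → ⟦ not (N j w) ⟧ ≤ size {s} (λ i → ⟦ not (N (toℕ i) w) ⟧)) (FP.toℕ-fromℕ< i<s)
            (≤-size (λ i → ⟦ not (N (toℕ i) w) ⟧) (F.fromℕ< i<s)))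
          (≤-<-trans (m≤n+m _ ⟦ labelled ℓ w ⟧) bad-w<1)))

        source : ∀ {w} i → i < s → N i w ≡ true →
          ∃ λ u → ℓ u ≡ i × adj u w ≡ true × Deliver G C (λ x → ℓ x ≡ i) u
        source i i<s Nw with nbrs-elim adj (group ℓ i) Nw
        ... | u , gu , uw with does-true (ℓ u ≟ i) gu
        ... | refl = u , refl , uw , delivers u i<s

        collect : ∀ w → bad w < 1 → RSolvable G C r
        collect w bad-w<1 with gather G ℓ s (unlabelled bad-w<1) (λ i i<s → source i i<s (adjacent bad-w<1 i i<s)) s ≤-refl
        ... | D , steps , s≤Dw , _ = solvable-≥ steps (accumulated D w s≤Dw)

        gathered : RSolvable G C r
        gathered = collect (proj₁ found) (proj₂ found)
          where
          found : ∃ λ w → bad w < 1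
          found = size-< {f = bad} {λ _ → 1} bad<n

      many-solvable : RSolvable G C r
      many-solvable = gathered (groups (suc q) ≤-refl)

    solvable : RSolvable G C r
    solvable with FP.any? (λ v → s ≤? C v)
    ... | yes (v , s≤Cv) = accumulated C v s≤Cv
    ... | no none with C r in Cr
    ... | suc _ = C , ε , subst (1 ≤_) (sym Cr) (s≤s z≤n)
    ... | zero with s ≤? count bigs
    ... | yes s≤b = Many.many-solvable (zeros≤bigs λ v → <⇒≤ (≰⇒> λ p → none (v , p))) s≤b
    ... | no  b<s with count-< {p = λ _ → false} {bigs} some-big
      where
      z≤sb : count zeros ≤ s * count bigs
      z≤sb = zeros≤bigs λ v → <⇒≤ (≰⇒> λ p → none (v , p))
      -- The empty root gives z ≥ 1, and z ≤ s · b then excludes b = 0.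
      some-big : count {n} (λ _ → false) < count bigs
      some-big = subst (_< count bigs) (sym (size-0 {n})) (pos (count bigs) refl)
        where
        pos : ∀ b → count bigs ≡ b → 0 < count bigs
        pos (suc b) eq = subst (0 <_) (sym eq) (s≤s z≤n)
        pos zero    eq = contradiction
          (≤-trans (count-∈ zeros {r} (cong isZero Cr)) (≤-trans z≤sb (≤-reflexive (trans (cong (s *_) eq) (*-zeroʳ s)))))
          (λ ())
    ... | u , _ , big = Few.few-solvable (≤-trans (zeros≤bigs λ v → <⇒≤ (≰⇒> λ p → none (v , p))) (*-monoʳ-≤ s (<⇒≤ (≰⇒> b<s)))) Cr u (isBig-true big)

-- Cycles and degrees

all-or-some : ∀ {m} {P Q : Fin m → Set} → (∀ i → P i ⊎ Q i) → (∀ i → P i) ⊎ ∃ Q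
all-or-some {zero}  c = inj₁ λ ()
all-or-some {suc m} c with c F.zero | all-or-some (c ∘ F.suc)
... | inj₂ q | _            = inj₂ (F.zero , q)
... | inj₁ p | inj₂ (i , q) = inj₂ (F.suc i , q)
... | inj₁ p | inj₁ ps      = inj₁ λ { F.zero → p ; (F.suc i) → ps i }

module _ {n} {adj : Matrix n} where

  path-within : ∀ m (f : Fin (suc m) → Fin n) →
    (∀ i → adj (f (F.inject₁ i)) (f (F.suc i)) ≡ true) → Within adj m (f F.zero) (f (F.fromℕ m))
  path-within zero    f e = here
  path-within (suc m) f e = cons (e F.zero) (path-within m (f ∘ F.suc) (e ∘ F.suc))

  broken-path-within : ∀ m (f : Fin (suc m) → Fin n) (i : Fin m) →
    (∀ j → j ≢ i → adj (f (F.inject₁ j)) (f (F.suc j)) ≡ true) →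
    ∃ λ a → ∃ λ b → Within adj a (f F.zero) (f (F.inject₁ i)) ×
      Within adj b (f (F.suc i)) (f (F.fromℕ m)) × suc (a + b) ≡ m
  broken-path-within (suc m) f F.zero e =
    0 , m , here , path-within m (f ∘ F.suc) (λ j → e (F.suc j) λ ()) , refl
  broken-path-within (suc m) f (F.suc i) e
    with broken-path-within m (f ∘ F.suc) i (λ j j≢i → e (F.suc j) (j≢i ∘ FP.suc-injective))
  ... | a , b , wa , wb , eq = suc a , b , cons (e F.zero λ ()) wa , wb , cong suc eq

module _ {n : ℕ} {adj adj′ : Matrix n} {sym-adj : Symmetric adj} {sym-adj′ : Symmetric adj′}
  {loopless : ∀ u → adj u u ≡ false} {loopless′ : ∀ u → adj′ u u ≡ false} {g : ℕ} {a b : Fin n}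
  (far : ¬ Within adj g a b)
  (old-or-new : ∀ u v → adj′ u v ≡ true → adj u v ≡ true ⊎ (u ≡ a × v ≡ b) ⊎ (u ≡ b × v ≡ a))
  where

  far-ends : ∀ {u v m} → (u ≡ a × v ≡ b) ⊎ (u ≡ b × v ≡ a) → Within adj m v u → g ≤ suc m
  far-ends {m = m} ends w with g ≤? suc m
  ... | yes le = le
  ... | no  ¬le with ends
  ... | inj₁ (refl , refl) = contradiction (reverse sym-adj (weaken (≤-trans (n≤1+n m) (≰⇒≥ ¬le)) w)) far
  ... | inj₂ (refl , refl) = contradiction (weaken (≤-trans (n≤1+n m) (≰⇒≥ ¬le)) w) far

  -- A cycle passes through the new edge at most once, since `f` is injective. Deleting that edge
  -- leaves a walk of m old edges between its ends, which `far` makes longer than `g`.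
  girth-extend : GirthAtLeast (graph adj sym-adj loopless) g → GirthAtLeast (graph adj′ sym-adj′ loopless′) g
  girth-extend girth (suc m) (3≤ , f , inj , e , c)
    with old-or-new _ _ c | all-or-some (λ i → old-or-new _ _ (e i))
  ... | inj₁ old | inj₁ olds = girth (suc m) (3≤ , f , inj , olds , old)
  ... | inj₂ new | inj₁ olds = far-ends new (path-within m f olds)
  ... | inj₁ old | inj₂ (i , new) with broken-path-within {adj = adj} m f i others
    where
    same : ∀ {j} → (f (F.inject₁ j) ≡ a × f (F.suc j) ≡ b) ⊎ (f (F.inject₁ j) ≡ b × f (F.suc j) ≡ a) →
      (f (F.inject₁ i) ≡ a × f (F.suc i) ≡ b) ⊎ (f (F.inject₁ i) ≡ b × f (F.suc i) ≡ a) → j ≡ i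
    -- The new edge met at `j` and `i` in opposite directions would give both j = i + 1 and i = j +
    -- 1.
    crossed : ∀ {j} → f (F.inject₁ j) ≡ f (F.suc i) → f (F.suc j) ≡ f (F.inject₁ i) → ⊥
    crossed {j} p q = <-irrefl (trans (sym (FP.toℕ-inject₁ j)) (cong toℕ (inj p)))
      (m≤n⇒m≤1+n (≤-reflexive (trans (cong toℕ (inj q)) (FP.toℕ-inject₁ i))))
    same (inj₁ (p , _)) (inj₁ (p′ , _)) = FP.inject₁-injective (inj (trans p (sym p′)))
    same (inj₂ (p , _)) (inj₂ (p′ , _)) = FP.inject₁-injective (inj (trans p (sym p′)))
    same (inj₁ (p , q)) (inj₂ (p′ , q′)) = ⊥-elim (crossed (trans p (sym q′)) (trans q (sym p′)))
    same (inj₂ (p , q)) (inj₁ (p′ , q′)) = ⊥-elim (crossed (trans p (sym q′)) (trans q (sym p′)))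
    others : ∀ j → j ≢ i → adj (f (F.inject₁ j)) (f (F.suc j)) ≡ true
    others j j≢i with old-or-new _ _ (e j)
    ... | inj₁ oldj = oldj
    ... | inj₂ newj = contradiction (same newj new) j≢i
  ... | x , y , wx , wy , eq = far-ends new
    (subst (λ k → Within adj k (f (F.suc i)) (f (F.inject₁ i))) (trans (+-suc x y) eq) (concat (snoc wy old) wx))
  girth-extend girth (suc m) (3≤ , f , inj , e , c) | inj₂ new | inj₂ (i , new′) = ⊥-elim (clash new new′)
    where
    last : F.inject₁ i ≡ F.fromℕ m → ⊥
    last p = <-irrefl (trans (sym (FP.toℕ-inject₁ i)) (trans (cong toℕ p) (FP.toℕ-fromℕ m))) (FP.toℕ<n i)
    -- A path edge that is the closing edge reversed joins the first vertex to the last, so m = 1;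
    -- cycles of length 2 are excluded by `3≤`.
    short : F.inject₁ i ≡ F.zero → F.suc i ≡ F.fromℕ m → ⊥
    short p q = <-irrefl (trans (cong suc (trans (sym (cong toℕ p)) (FP.toℕ-inject₁ i))) (trans (cong toℕ q) (FP.toℕ-fromℕ m)))
      (≤-pred 3≤)
    clash : (f (F.fromℕ m) ≡ a × f F.zero ≡ b) ⊎ (f (F.fromℕ m) ≡ b × f F.zero ≡ a) →
      (f (F.inject₁ i) ≡ a × f (F.suc i) ≡ b) ⊎ (f (F.inject₁ i) ≡ b × f (F.suc i) ≡ a) → ⊥
    clash (inj₁ (p , _)) (inj₁ (p′ , _)) = last (inj (trans p′ (sym p)))
    clash (inj₂ (p , _)) (inj₂ (p′ , _)) = last (inj (trans p′ (sym p)))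
    clash (inj₁ (p , q)) (inj₂ (p′ , q′)) = short (inj (trans p′ (sym q))) (inj (trans q′ (sym p)))
    clash (inj₂ (p , q)) (inj₁ (p′ , q′)) = short (inj (trans p′ (sym q))) (inj (trans q′ (sym p)))

-- Graphs given by lists of chosen edges, and their degrees

Edges : ℕ → Set
Edges n = List (Fin n × Fin n)

joins : ∀ {n} → Fin n → Fin n → Matrix n
joins a b u v = (a == u) ∧ (b == v) ∨ (a == v) ∧ (b == u)

edge-matrix : ∀ {n} → Edges n → Matrix n
edge-matrix []            u v = false
edge-matrix ((a , b) ∷ E) u v = joins a b u v ∨ edge-matrix E u v

outdeg indeg : ∀ {n} → Edges n → Fin n → ℕ
outdeg []            u = 0
outdeg ((a , _) ∷ E) u = [ a ≡? u ] + outdeg E u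
indeg []            u = 0
indeg ((_ , b) ∷ E) u = [ b ≡? u ] + indeg E u

joins-elim : ∀ {n} {a b u v : Fin n} → joins a b u v ≡ true → (u ≡ a × v ≡ b) ⊎ (u ≡ b × v ≡ a)
joins-elim {a = a} {b} {u} {v} p with ∨-elim {(a == u) ∧ (b == v)} p
... | inj₁ q = inj₁ (sym (==-sound {a = a} {u} (proj₁ (∧-elim {a == u} q))) , sym (==-sound {a = b} {v} (proj₂ (∧-elim {a == u} q))))
... | inj₂ q = inj₂ (sym (==-sound {a = b} {u} (proj₂ (∧-elim {a == v} q))) , sym (==-sound {a = a} {v} (proj₁ (∧-elim {a == v} q))))

joins-intro : ∀ {n} (a b : Fin n) → joins a b a b ≡ true
joins-intro a b = ∨-introˡ (∧-intro (==-refl a) (==-refl b))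

joins-sym : ∀ {n} (a b : Fin n) → joins a b b a ≡ true
joins-sym a b = ∨-introʳ {(a == b) ∧ (b == a)} (∧-intro (==-refl a) (==-refl b))

edge-matrix-elim : ∀ {n} {a b : Fin n} E u v → edge-matrix ((a , b) ∷ E) u v ≡ true →
  edge-matrix E u v ≡ true ⊎ (u ≡ a × v ≡ b) ⊎ (u ≡ b × v ≡ a)
edge-matrix-elim {a = a} {b} E u v p with ∨-elim {joins a b u v} p
... | inj₁ q = inj₂ (joins-elim {a = a} {b} {u} {v} q)
... | inj₂ q = inj₁ q

edge-matrix-sym : ∀ {n} (E : Edges n) → Symmetric (edge-matrix E)
edge-matrix-sym ((a , b) ∷ E) u v p with edge-matrix-elim {a = a} {b} E u v p
... | inj₁ old = ∨-introʳ {joins a b v u} (edge-matrix-sym E u v old)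
... | inj₂ (inj₁ (refl , refl)) = ∨-introˡ (joins-sym a b)
... | inj₂ (inj₂ (refl , refl)) = ∨-introˡ (joins-intro a b)

∧-⟦⟧ : ∀ a b → ⟦ a ∧ b ⟧ ≡ ⟦ a ⟧ * ⟦ b ⟧
∧-⟦⟧ true  b = sym (+-identityʳ ⟦ b ⟧)
∧-⟦⟧ false b = refl

count-[≡?]-∧ : ∀ {n} (a u b : Fin n) → count (λ x → (a == u) ∧ (b == x)) ≡ [ a ≡? u ]
count-[≡?]-∧ a u b = begin
  count (λ x → (a == u) ∧ (b == x))          ≡⟨ size-cong pointwise ⟩
  size (λ x → [ a ≡? u ] * [ x ≡? b ])       ≡⟨ size-* [ a ≡? u ] (λ x → [ x ≡? b ]) ⟩
  [ a ≡? u ] * size (λ x → [ x ≡? b ])       ≡⟨ cong ([ a ≡? u ] *_) (size-[≡?] b) ⟩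
  [ a ≡? u ] * 1                             ≡⟨ *-identityʳ _ ⟩
  [ a ≡? u ]                                 ∎
  where
  open ≡-Reasoning
  pointwise : ∀ x → ⟦ (a == u) ∧ (b == x) ⟧ ≡ [ a ≡? u ] * [ x ≡? b ]
  pointwise x = trans (∧-⟦⟧ (a == u) (b == x)) (cong₂ _*_ (sym ([≡?]≡⟦==⟧ a u))
    (trans (sym ([≡?]≡⟦==⟧ b x)) ([≡?]-sym b x)))

∧-comm-⟦⟧ : ∀ a b → ⟦ a ∧ b ⟧ ≡ ⟦ b ∧ a ⟧
∧-comm-⟦⟧ a b = trans (∧-⟦⟧ a b) (trans (*-comm ⟦ a ⟧ ⟦ b ⟧) (sym (∧-⟦⟧ b a)))

degree-≤ : ∀ {n} (E : Edges n) u → count (edge-matrix E u) ≤ outdeg E u + indeg E u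
degree-≤ {n} []            u = ≤-reflexive (size-0 {n})
degree-≤ ((a , b) ∷ E) u = begin
  count (λ x → joins a b u x ∨ edge-matrix E u x)
    ≤⟨ count-∨ (joins a b u) (edge-matrix E u) ⟩
  count (joins a b u) + count (edge-matrix E u)
    ≤⟨ +-mono-≤ (≤-trans (count-∨ (λ x → (a == u) ∧ (b == x)) (λ x → (a == x) ∧ (b == u))) (≤-reflexive ends)) (degree-≤ E u) ⟩
  ([ a ≡? u ] + [ b ≡? u ]) + (outdeg E u + indeg E u)
    ≡⟨ regroup [ a ≡? u ] [ b ≡? u ] (outdeg E u) (indeg E u) ⟩
  ([ a ≡? u ] + outdeg E u) + ([ b ≡? u ] + indeg E u) ∎
  where
  open ≤-Reasoning
  regroup : ∀ p q r s → (p + q) + (r + s) ≡ (p + r) + (q + s)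
  regroup = solve-∀
  ends : count (λ x → (a == u) ∧ (b == x)) + count (λ x → (a == x) ∧ (b == u)) ≡ [ a ≡? u ] + [ b ≡? u ]
  ends = cong₂ _+_ (count-[≡?]-∧ a u b)
    (trans (size-cong (λ x → ∧-comm-⟦⟧ (a == x) (b == u))) (count-[≡?]-∧ b u a))

size-indeg : ∀ {n} (E : Edges n) → size (indeg E) ≡ length E
size-indeg {n} []        = size-0 {n}
size-indeg ((a , b) ∷ E) = trans (size-+ (λ u → [ b ≡? u ]) (indeg E))
  (cong₂ _+_ (trans (size-cong ([≡?]-sym b)) (size-[≡?] b)) (size-indeg E))

nbrs-size : ∀ {n} (adj : Matrix n) {Δ} → (∀ u → count (adj u) ≤ Δ) → ∀ A → count (nbrs adj A) ≤ Δ * count A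
nbrs-size {n} adj {Δ} deg A = begin
  count (nbrs adj A)                                ≤⟨ size-mono (λ v → anyᶠ-≤ (λ u → A u ∧ adj u v)) ⟩
  size (λ v → size (λ u → ⟦ A u ∧ adj u v ⟧))       ≡⟨ size-swap (λ v u → ⟦ A u ∧ adj u v ⟧) ⟩
  size (λ u → count (λ v → A u ∧ adj u v))          ≤⟨ size-mono row ⟩
  size (λ u → Δ * ⟦ A u ⟧)                          ≡⟨ size-* Δ (λ u → ⟦ A u ⟧) ⟩
  Δ * count A                                       ∎
  where
  open ≤-Reasoning
  row : ∀ u → count (λ v → A u ∧ adj u v) ≤ Δ * ⟦ A u ⟧
  row u with A u
  ... | true  = ≤-trans (deg u) (≤-reflexive (sym (*-identityʳ Δ)))
  ... | false = ≤-trans (≤-reflexive (size-0 {n})) z≤n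

ball-size : ∀ {n} (adj : Matrix n) {Δ} → (∀ u → count (adj u) ≤ Δ) → ∀ a k → count (ball adj a k) ≤ suc Δ ^ k
ball-size adj deg a zero = ≤-reflexive (trans (size-cong (λ v → sym ([≡?]≡⟦==⟧ v a))) (size-[≡?] a))
ball-size adj {Δ} deg a (suc k) = begin
  count (ball adj a (suc k))                                    ≤⟨ count-∨ (ball adj a k) (nbrs adj (ball adj a k)) ⟩
  count (ball adj a k) + count (nbrs adj (ball adj a k))        ≤⟨ +-monoʳ-≤ (count (ball adj a k)) (nbrs-size adj deg (ball adj a k)) ⟩
  suc Δ * count (ball adj a k)                                  ≤⟨ *-monoʳ-≤ (suc Δ) (ball-size adj deg a k) ⟩
  suc Δ * suc Δ ^ k                                             ∎
  where open ≤-Reasoning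

truncate : ∀ {n} (p : Fin n → Bool) k → k ≤ count p → ∃ λ q → count q ≡ k × (∀ x → q x ≡ true → p x ≡ true)
truncate {zero}  p .0 z≤n = p , refl , λ x px → px
truncate {suc n} p k k≤ with p F.zero in p0
truncate {suc n} p zero k≤ | true = (λ _ → false) , size-0 {n} , λ _ ()
truncate {suc n} p (suc k) (s≤s k≤) | true with truncate (p ∘ F.suc) k k≤
... | q , q≡k , q⊆p = true V.∷ q , cong suc q≡k , λ { F.zero _ → p0 ; (F.suc x) → q⊆p x }
truncate {suc n} p k k≤ | false with truncate (p ∘ F.suc) k k≤
... | q , q≡k , q⊆p = false V.∷ q , q≡k , λ { F.zero () ; (F.suc x) → q⊆p x }

pick : ∀ {n} (q : Fin n → Bool) (f : Fin n → ℕ) c → size (λ x → ⟦ q x ⟧ * f x) < count q * c →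
  ∃ λ x → q x ≡ true × f x < c
pick q f c lt with size-< {f = λ x → ⟦ q x ⟧ * f x} {λ x → c * ⟦ q x ⟧}
  (subst (size (λ x → ⟦ q x ⟧ * f x) <_) (trans (*-comm (count q) c) (sym (size-* c (λ x → ⟦ q x ⟧)))) lt)
... | x , fx<c with q x in qx
... | true  = x , qx , subst₂ _<_ (+-identityʳ (f x)) (*-identityʳ c) fx<c
... | false = contradiction (subst (0 <_) (*-zeroʳ c) fx<c) λ ()

-- Greedy choice of edges

Event : ℕ → Set
Event n = (Fin n → Bool) × (Fin n → Bool)

module _ {n : ℕ} (N : ℕ) where

  -- The indicator that all choices made so far by `A` lie in `T`, written as a product so that it
  -- composes with `weight`. In an edge `(a , b)` the choice is made by `a`; the reverse direction
  -- is ignored.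
  avoids : Event n → Edges n → ℕ
  avoids (A , T) []            = 1
  avoids (A , T) ((a , b) ∷ E) = (if A a then ⟦ T b ⟧ else 1) * avoids (A , T) E

  -- N^|S| times an upper bound for the probability that the choices for the slots S
  -- send every slot of A into T.
  weight : Event n → List (Fin n) → ℕ
  weight (A , T) []      = 1
  weight (A , T) (v ∷ S) = (if A v then count T else N) * weight (A , T) S

  potential : List (Event n) → Edges n → List (Fin n) → ℕ
  potential evs E S = sum (map (λ ev → avoids ev E * weight ev S) evs)

  -- `q` is the set of admissible targets of the slot. If `v` is in `A`, at most `count T` of them
  -- lie in `T`, whatever `q` is, so the bound does not depend on earlier choices. If not, the
  -- factor is `count q`, which must match the N in `weight`; hence targets are cut down to exactly
  -- N.
  weight-step : ∀ ev v E S (q : Fin n → Bool) → count q ≡ N →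
    size (λ x → ⟦ q x ⟧ * (avoids ev ((v , x) ∷ E) * weight ev S)) ≤ avoids ev E * weight ev (v ∷ S)
  weight-step ev@(A , T) v E S q q≡N with A v
  ... | true = begin
    size (λ x → ⟦ q x ⟧ * ((⟦ T x ⟧ * a) * w))   ≤⟨ size-mono (λ x → ≤-trans (*-monoˡ-≤ _ (⟦⟧≤1 (q x))) (≤-reflexive (regroup ⟦ T x ⟧ a w))) ⟩
    size (λ x → (a * w) * ⟦ T x ⟧)               ≡⟨ size-* (a * w) (λ x → ⟦ T x ⟧) ⟩
    (a * w) * count T                            ≡⟨ swap a w (count T) ⟩
    a * (count T * w)                            ∎
    where
    open ≤-Reasoning
    a w : ℕ
    a = avoids ev E
    w = weight ev S
    regroup : ∀ t a w → 1 * ((t * a) * w) ≡ (a * w) * t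
    regroup = solve-∀
    swap : ∀ a w t → (a * w) * t ≡ a * (t * w)
    swap = solve-∀
  ... | false = ≤-reflexive (begin
    size (λ x → ⟦ q x ⟧ * ((1 * a) * w))         ≡⟨ size-cong (λ x → regroup ⟦ q x ⟧ a w) ⟩
    size (λ x → (a * w) * ⟦ q x ⟧)               ≡⟨ size-* (a * w) (λ x → ⟦ q x ⟧) ⟩
    (a * w) * count q                            ≡⟨ cong ((a * w) *_) q≡N ⟩
    (a * w) * N                                  ≡⟨ swap a w N ⟩
    a * (N * w)                                  ∎)
    where
    open ≡-Reasoning
    a w : ℕ
    a = avoids ev E
    w = weight ev S
    regroup : ∀ t a w → t * ((1 * a) * w) ≡ (a * w) * t
    regroup = solve-∀
    swap : ∀ a w t → (a * w) * t ≡ a * (t * w)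
    swap = solve-∀

  potential-step : ∀ evs v E S (q : Fin n → Bool) → count q ≡ N →
    size (λ x → ⟦ q x ⟧ * potential evs ((v , x) ∷ E) S) ≤ potential evs E (v ∷ S)
  potential-step [] v E S q q≡N = ≤-reflexive (trans (size-cong (λ x → *-zeroʳ ⟦ q x ⟧)) (size-0 {n}))
  potential-step (ev ∷ evs) v E S q q≡N = begin
    size (λ x → ⟦ q x ⟧ * (f x + rest x))                       ≡⟨ size-cong (λ x → *-distribˡ-+ ⟦ q x ⟧ (f x) (rest x)) ⟩
    size (λ x → ⟦ q x ⟧ * f x + ⟦ q x ⟧ * rest x)               ≡⟨ size-+ (λ x → ⟦ q x ⟧ * f x) (λ x → ⟦ q x ⟧ * rest x) ⟩
    size (λ x → ⟦ q x ⟧ * f x) + size (λ x → ⟦ q x ⟧ * rest x)  ≤⟨ +-mono-≤ (weight-step ev v E S q q≡N) (potential-step evs v E S q q≡N) ⟩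
    potential (ev ∷ evs) E (v ∷ S)                              ∎
    where
    open ≤-Reasoning
    f rest : Fin n → ℕ
    f x = avoids ev ((v , x) ∷ E) * weight ev S
    rest x = potential evs ((v , x) ∷ E) S

  avoids-zero : ∀ ev E → avoids ev E ≡ 0 → ∃ λ u → ∃ λ v → proj₁ ev u ≡ true × proj₂ ev v ≡ false × edge-matrix E u v ≡ true
  avoids-zero ev@(A , T) ((a , b) ∷ E) eq with m*n≡0⇒m≡0∨n≡0 (if A a then ⟦ T b ⟧ else 1) eq
  ... | inj₂ z with avoids-zero ev E z
  ... | u , v , Au , Tv , uv = u , v , Au , Tv , ∨-introʳ {joins a b u v} uv
  avoids-zero ev@(A , T) ((a , b) ∷ E) eq | inj₁ z with A a in Aa | T b in Tb
  ... | true | false = a , b , Aa , Tb , ∨-introˡ (joins-intro a b)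

occ : ∀ {n} → List (Fin n) → Fin n → ℕ
occ S u = sum (map (λ v → [ v ≡? u ]) S)

-- `e` bounds the targets ruled out for a slot: half of it for vertices of full indegree, few
-- because there are at most n · D edges, and half for the ball of radius `g` around the chooser. So
-- N targets always remain.
module Greedy {n} (D cap g N e : ℕ) (evs : List (Event n)) (N+e≤n : N + e ≤ n)
  (saturated-few : ∀ c → c * cap ≤ n * D → 2 * c ≤ e) (ball-small : 2 * suc (D + cap) ^ g ≤ e) where

  record Inv (E : Edges n) (S : List (Fin n)) : Set where
    field
      -- Open slots count together with edges already chosen: a choice leaves the sum unchanged, and
      -- the outdegree never exceeds D.
      out      : ∀ u → outdeg E u + occ S u ≤ D
      inn      : ∀ u → indeg E u ≤ cap
      len      : length E + length S ≤ n * D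
      loopless : ∀ u → edge-matrix E u u ≡ false
      girth    : GirthAtLeast (graph (edge-matrix E) (edge-matrix-sym E) loopless) g

  module _ {E v S} (inv : Inv E (v ∷ S)) where
    open Inv inv

    saturated bad : Fin n → Bool
    saturated x = does (cap ≤? indeg E x)
    bad x = saturated x ∨ ball (edge-matrix E) v g x

    bad≤e : count bad ≤ e
    bad≤e = *-cancelˡ-≤ 2 (begin
      2 * count bad                              ≤⟨ *-monoʳ-≤ 2 (count-∨ saturated b) ⟩
      2 * (count saturated + count b)            ≡⟨ *-distribˡ-+ 2 (count saturated) (count b) ⟩
      2 * count saturated + 2 * count b          ≤⟨ +-mono-≤ (saturated-few (count saturated) sat) (≤-trans (*-monoʳ-≤ 2 (ball-size (edge-matrix E) degree v g)) ball-small) ⟩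
      e + e                                      ≡⟨ cong (e +_) (+-identityʳ e) ⟨
      2 * e                                      ∎)
      where
      open ≤-Reasoning
      b : Fin n → Bool
      b = ball (edge-matrix E) v g
      degree : ∀ u → count (edge-matrix E u) ≤ D + cap
      degree u = ≤-trans (degree-≤ E u) (+-mono-≤ (≤-trans (m≤m+n _ _) (out u)) (inn u))
      pointwise : ∀ x → cap * ⟦ saturated x ⟧ ≤ indeg E x
      pointwise x = at-least (cap ≤? indeg E x)
        where
        at-least : (d : Dec (cap ≤ indeg E x)) → cap * ⟦ does d ⟧ ≤ indeg E x
        at-least (yes le) = ≤-trans (≤-reflexive (*-identityʳ cap)) le
        at-least (no  _)  = ≤-trans (≤-reflexive (*-zeroʳ cap)) z≤n
      sat : count saturated * cap ≤ n * D
      sat = begin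
        count saturated * cap                  ≡⟨ *-comm (count saturated) cap ⟩
        cap * count saturated                  ≡⟨ size-* cap (λ x → ⟦ saturated x ⟧) ⟨
        size (λ x → cap * ⟦ saturated x ⟧)     ≤⟨ size-mono pointwise ⟩
        size (indeg E)                         ≡⟨ size-indeg E ⟩
        length E                               ≤⟨ m≤m+n _ _ ⟩
        length E + suc (length S)              ≤⟨ len ⟩
        n * D                                  ∎

    N≤good : N ≤ count (not ∘ bad)
    N≤good = +-cancelˡ-≤ (count bad) _ _ (begin
      count bad + N                  ≡⟨ +-comm (count bad) N ⟩
      N + count bad                  ≤⟨ +-monoʳ-≤ N bad≤e ⟩
      N + e                          ≤⟨ N+e≤n ⟩
      n                              ≡⟨ count-not bad ⟨
      count bad + count (not ∘ bad)  ∎)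
      where open ≤-Reasoning

    inv-step : ∀ {x} → not (bad x) ≡ true → Inv ((v , x) ∷ E) S
    inv-step {x} good = record
      { out = λ u → ≤-trans (≤-reflexive (regroup [ v ≡? u ] (outdeg E u) (occ S u))) (out u)
      ; inn = inn′
      ; len = ≤-trans (≤-reflexive (sym (+-suc (length E) (length S)))) len
      ; loopless = loopless′
      ; girth = girth-extend {adj = edge-matrix E} {edge-matrix ((v , x) ∷ E)}
          {edge-matrix-sym E} {edge-matrix-sym ((v , x) ∷ E)} {loopless} {loopless′} far
          (edge-matrix-elim {a = v} {x} E) girth }
      where
      parts : saturated x ≡ false × ball (edge-matrix E) v g x ≡ false
      parts = ∨-false {saturated x} (not-true good)
      far : ¬ Within (edge-matrix E) g v x
      far w = true≢false (ball-complete w) (proj₂ parts)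
      regroup : ∀ a b c → (a + b) + c ≡ b + (a + c)
      regroup = solve-∀
      inn′ : ∀ u → indeg ((v , x) ∷ E) u ≤ cap
      inn′ u with x F.≟ u
      ... | yes refl = ≰⇒> (does-false (cap ≤? indeg E x) (proj₁ parts))
      ... | no _     = inn u
      loopless′ : ∀ u → edge-matrix ((v , x) ∷ E) u u ≡ false
      loopless′ u with edge-matrix ((v , x) ∷ E) u u in uu
      ... | false = refl
      ... | true with edge-matrix-elim {a = v} {x} E u u uu
      ... | inj₁ old = trans (sym old) (loopless u)
      -- The chooser lies in its own ball, so `far` also excludes loops.
      ... | inj₂ (inj₁ (refl , refl)) = contradiction (weaken z≤n here) far
      ... | inj₂ (inj₂ (refl , refl)) = contradiction (weaken z≤n here) far

  complete : ∀ S E → Inv E S → potential N evs E S < N ^ length S →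
    ∃ λ E′ → Inv E′ [] × potential N evs E′ [] < 1
  complete []      E inv small = E , inv , small
  complete (v ∷ S) E inv small with truncate (not ∘ bad inv) N (N≤good inv)
  ... | q , q≡N , q⊆good with pick q (λ x → potential N evs ((v , x) ∷ E) S) (N ^ length S)
    (≤-<-trans (potential-step N evs v E S q q≡N) (subst (λ c → potential N evs E (v ∷ S) < c * N ^ length S) (sym q≡N) small))
  ... | x , qx , small′ = complete S ((v , x) ∷ E) (inv-step inv (q⊆good x qx)) small′

-- Union bound over the possible violations of expansion

subsets : ∀ n → ℕ → List (Fin n → Bool)
subsets zero    k       = (λ ()) ∷ []
subsets (suc n) zero    = (λ _ → false) ∷ []
subsets (suc n) (suc k) = map (true V.∷_) (subsets n k) ++ map (false V.∷_) (subsets n (suc k))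

length-subsets : ∀ n k → length (subsets n k) ≤ suc n ^ k
length-subsets zero    k       = ≤-reflexive (sym (^-zeroˡ k))
length-subsets (suc n) zero    = ≤-refl
length-subsets (suc n) (suc k) = begin
  length (subsets (suc n) (suc k))
    ≡⟨ length-++ (map (true V.∷_) (subsets n k)) ⟩
  length (map (true V.∷_) (subsets n k)) + length (map (false V.∷_) (subsets n (suc k)))
    ≡⟨ cong₂ _+_ (length-map (true V.∷_) (subsets n k)) (length-map (false V.∷_) (subsets n (suc k))) ⟩
  length (subsets n k) + length (subsets n (suc k))
    ≤⟨ +-mono-≤ (length-subsets n k) (length-subsets n (suc k)) ⟩
  suc (suc n) * suc n ^ k
    ≤⟨ *-monoʳ-≤ (suc (suc n)) (^-monoˡ-≤ k (n≤1+n (suc n))) ⟩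
  suc (suc n) ^ suc k ∎
  where open ≤-Reasoning

subsets-complete : ∀ {n} k (A : Fin n → Bool) → count A ≤ k → ∃ λ A′ → A′ ∈ subsets n k × (∀ x → A′ x ≡ A x)
subsets-complete {zero}  k       A _  = (λ ()) , here refl , λ ()
subsets-complete {suc n} zero    A A≤ = (λ _ → false) , here refl , λ x → sym (empty x)
  where
  empty : ∀ x → A x ≡ false
  empty x with A x in Ax
  ... | false = refl
  ... | true  = contradiction (≤-trans (count-∈ A Ax) A≤) λ ()
subsets-complete {suc n} (suc k) A A≤ with A F.zero in A0
... | true with subsets-complete k (A ∘ F.suc) (≤-pred A≤)
... | A′ , A′∈ , A′≗A = true V.∷ A′ , ∈-++⁺ˡ (∈-map⁺ (true V.∷_) A′∈) , λ { F.zero → sym A0 ; (F.suc x) → A′≗A x }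
subsets-complete {suc n} (suc k) A A≤ | false with subsets-complete (suc k) (A ∘ F.suc) A≤
... | A′ , A′∈ , A′≗A = false V.∷ A′ , ∈-++⁺ʳ (map (true V.∷_) (subsets n k)) (∈-map⁺ (false V.∷_) A′∈) ,
  λ { F.zero → sym A0 ; (F.suc x) → A′≗A x }

length-cartesianProduct : ∀ {A B : Set} (xs : List A) (ys : List B) →
  length (cartesianProduct xs ys) ≡ length xs * length ys
length-cartesianProduct []       ys = refl
length-cartesianProduct (x ∷ xs) ys = trans (length-++ (map (x ,_) ys))
  (cong₂ _+_ (length-map (x ,_) ys) (length-cartesianProduct xs ys))

slots : ∀ {n} → ℕ → List (Fin n) → List (Fin n)
slots D = concatMap (replicate D)

module _ {n} (N D K h y : ℕ) (1≤N : 1 ≤ N)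
  (1+n^K+2≤2^y : suc n ^ (2 + K) ≤ 2 ^ y) (decay : ∀ t → t + h ≤ n → 2 ^ y * t ^ D ≤ N ^ D) where

  Valid : ℕ → Event n → Set
  Valid a (A , T) = count A ≡ a × count T + h ≤ n

  valid? : ∀ a ev → Dec (Valid a ev)
  valid? a (A , T) = count A ≟ a ×-dec count T + h ≤? n

  -- `subsets` also lists smaller sets. The filter restores the exact size of `A`, on which the
  -- factor `2 ^ (y * a)` depends.
  events-of-size : ℕ → List (Event n)
  events-of-size a = filter (valid? a) (cartesianProduct (subsets n a) (subsets n (K * a)))

  events : ℕ → List (Event n)
  events zero    = []
  events (suc a) = events-of-size (suc a) ++ events a

  occurrences : (Fin n → Bool) → List (Fin n) → ℕ
  occurrences A vs = sum (map (λ v → ⟦ A v ⟧) vs)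

  weight-replicate : ∀ (A T : Fin n → Bool) d v S → weight N (A , T) (replicate d v ++ S) ≡
    (if A v then count T else N) ^ d * weight N (A , T) S
  weight-replicate A T zero    v S = sym (+-identityʳ _)
  weight-replicate A T (suc d) v S =
    trans (cong ((if A v then count T else N) *_) (weight-replicate A T d v S))
          (sym (*-assoc (if A v then count T else N) _ _))

  -- A vertex of `A` makes D choices, and by `decay` the chance that all fall into `T` is at most
  -- 2^(-y); these factors multiply over the vertices of `A`.
  weight-slots : ∀ (A T : Fin n → Bool) → count T + h ≤ n → ∀ vs →
    2 ^ (y * occurrences A vs) * weight N (A , T) (slots D vs) ≤ N ^ length (slots D vs)
  weight-slots A T T≤ [] = ≤-reflexive (trans (*-identityʳ _) (cong (2 ^_) (*-zeroʳ y)))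
  weight-slots A T T≤ (v ∷ vs) = begin
    2 ^ (y * (⟦ A v ⟧ + o)) * weight N (A , T) (replicate D v ++ slots D vs)
      ≡⟨ cong₂ _*_ (trans (cong (2 ^_) (*-distribˡ-+ y ⟦ A v ⟧ o)) (^-distribˡ-+-* 2 (y * ⟦ A v ⟧) (y * o)))
           (weight-replicate A T D v (slots D vs)) ⟩
    (2 ^ (y * ⟦ A v ⟧) * 2 ^ (y * o)) * (f ^ D * w)
      ≡⟨ regroup (2 ^ (y * ⟦ A v ⟧)) (2 ^ (y * o)) (f ^ D) w ⟩
    (2 ^ (y * ⟦ A v ⟧) * f ^ D) * (2 ^ (y * o) * w)
      ≤⟨ *-mono-≤ head (weight-slots A T T≤ vs) ⟩
    N ^ D * N ^ length (slots D vs)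
      ≡⟨ ^-distribˡ-+-* N D (length (slots D vs)) ⟨
    N ^ (D + length (slots D vs))
      ≡⟨ cong (λ d → N ^ (d + length (slots D vs))) (length-replicate D) ⟨
    N ^ (length (replicate D v) + length (slots D vs))
      ≡⟨ cong (N ^_) (length-++ (replicate D v)) ⟨
    N ^ length (replicate D v ++ slots D vs) ∎
    where
    open ≤-Reasoning
    o w f : ℕ
    o = occurrences A vs
    w = weight N (A , T) (slots D vs)
    f = if A v then count T else N
    regroup : ∀ a b c d → (a * b) * (c * d) ≡ (a * c) * (b * d)
    regroup = solve-∀
    head : 2 ^ (y * ⟦ A v ⟧) * f ^ D ≤ N ^ D
    head with A v
    ... | true  = ≤-trans (≤-reflexive (cong (λ j → 2 ^ j * count T ^ D) (*-identityʳ y))) (decay (count T) T≤)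
    ... | false = ≤-reflexive (trans (cong (λ j → 2 ^ j * N ^ D) (*-zeroʳ y)) (+-identityʳ _))

  private
    S : List (Fin n)
    S = slots D (allFin n)

  sum-bound : ∀ (f : Event n → ℕ) c Y {l} → All (λ ev → c * f ev ≤ Y) l → c * sum (map f l) ≤ length l * Y
  sum-bound f c Y []       = ≤-reflexive (*-zeroʳ c)
  sum-bound f c Y (p ∷ ps) = ≤-trans (≤-reflexive (*-distribˡ-+ c _ _)) (+-mono-≤ p (sum-bound f c Y ps))

  -- There are at most (n+1)^(a + Ka) pairs. The spare factor `suc n` makes every size contribute at
  -- most a share 1/(n+1), so that the n sizes together stay below 1.
  few-events : ∀ a → 1 ≤ a → suc n * length (events-of-size a) ≤ 2 ^ (y * a)
  few-events a 1≤a = begin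
    suc n * length (events-of-size a)
      ≤⟨ *-monoʳ-≤ (suc n) (length-filter (valid? a) (cartesianProduct (subsets n a) (subsets n (K * a)))) ⟩
    suc n * length (cartesianProduct (subsets n a) (subsets n (K * a)))
      ≡⟨ cong (suc n *_) (length-cartesianProduct (subsets n a) (subsets n (K * a))) ⟩
    suc n * (length (subsets n a) * length (subsets n (K * a)))
      ≤⟨ *-monoʳ-≤ (suc n) (*-mono-≤ (length-subsets n a) (length-subsets n (K * a))) ⟩
    suc n * (suc n ^ a * suc n ^ (K * a))
      ≡⟨ cong (suc n *_) (^-distribˡ-+-* (suc n) a (K * a)) ⟨
    suc n ^ suc (a + K * a)
      ≤⟨ ^-monoʳ-≤ (suc n) (+-monoˡ-≤ (a + K * a) 1≤a) ⟩
    suc n ^ ((2 + K) * a)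
      ≡⟨ ^-*-assoc (suc n) (2 + K) a ⟨
    (suc n ^ (2 + K)) ^ a
      ≤⟨ ^-monoˡ-≤ a 1+n^K+2≤2^y ⟩
    (2 ^ y) ^ a
      ≡⟨ ^-*-assoc 2 y a ⟩
    2 ^ (y * a) ∎
    where open ≤-Reasoning

  potential-of-size : ∀ a → 1 ≤ a → suc n * potential N (events-of-size a) [] S ≤ N ^ length S
  potential-of-size a 1≤a = *-cancelˡ-≤ (2 ^ (y * a)) {{m^n≢0 2 (y * a)}} (begin
    2 ^ (y * a) * (suc n * potential N evs [] S)    ≡⟨ swap (2 ^ (y * a)) (suc n) _ ⟩
    suc n * (2 ^ (y * a) * potential N evs [] S)    ≤⟨ *-monoʳ-≤ (suc n) (sum-bound (λ ev → avoids N ev [] * weight N ev S) (2 ^ (y * a)) (N ^ length S)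
                                                         (All.map (λ {ev} → each {ev}) (all-filter (valid? a) (cartesianProduct (subsets n a) (subsets n (K * a)))))) ⟩
    suc n * (length evs * N ^ length S)             ≡⟨ *-assoc (suc n) (length evs) _ ⟨
    (suc n * length evs) * N ^ length S             ≤⟨ *-monoˡ-≤ (N ^ length S) (few-events a 1≤a) ⟩
    2 ^ (y * a) * N ^ length S                      ∎)
    where
    open ≤-Reasoning
    evs : List (Event n)
    evs = events-of-size a
    swap : ∀ a b c → a * (b * c) ≡ b * (a * c)
    swap = solve-∀
    each : ∀ {ev} → Valid a ev → 2 ^ (y * a) * (avoids N ev [] * weight N ev S) ≤ N ^ length S
    each {A , T} (A≡a , T≤) = subst (λ j → 2 ^ (y * j) * (1 * weight N (A , T) S) ≤ N ^ length S)
      (trans (cong sum (map-tabulate (λ x → x) (λ v → ⟦ A v ⟧))) A≡a)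
      (subst (λ w → 2 ^ (y * occurrences A (allFin n)) * w ≤ N ^ length S) (sym (+-identityʳ _)) (weight-slots A T T≤ (allFin n)))

  potential-++ : ∀ (l l′ : List (Event n)) E S → potential N (l ++ l′) E S ≡ potential N l E S + potential N l′ E S
  potential-++ l l′ E S = trans (cong sum (map-++ _ l l′)) (sum-++ (map _ l) _)

  potential-events : ∀ a → suc n * potential N (events a) [] S ≤ a * N ^ length S
  potential-events zero    = ≤-reflexive (*-zeroʳ (suc n))
  potential-events (suc a) = begin
    suc n * potential N (events (suc a)) [] S
      ≡⟨ cong (suc n *_) (potential-++ (events-of-size (suc a)) (events a) [] S) ⟩
    suc n * (potential N (events-of-size (suc a)) [] S + potential N (events a) [] S)
      ≡⟨ *-distribˡ-+ (suc n) (potential N (events-of-size (suc a)) [] S) _ ⟩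
    suc n * potential N (events-of-size (suc a)) [] S + suc n * potential N (events a) [] S
      ≤⟨ +-mono-≤ (potential-of-size (suc a) (s≤s z≤n)) (potential-events a) ⟩
    suc a * N ^ length S ∎
    where open ≤-Reasoning

  initial-potential : potential N (events n) [] S < N ^ length S
  initial-potential = *-cancelˡ-< (suc n) _ _ (≤-<-trans (potential-events n)
    (*-monoˡ-< (N ^ length S) {{m^n≢0 N (length S) {{>-nonZero 1≤N}}}} (n<1+n n)))

  events-complete : ∀ a m → 1 ≤ a → a ≤ m → ∀ {ev} → ev ∈ events-of-size a → ev ∈ events m
  events-complete a zero    1≤a a≤m ev∈ = contradiction (≤-trans 1≤a a≤m) λ ()
  events-complete a (suc m) 1≤a a≤m ev∈ with m≤n⇒m<n∨m≡n a≤m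
  ... | inj₂ refl = ∈-++⁺ˡ ev∈
  ... | inj₁ a<1+m = ∈-++⁺ʳ (events-of-size (suc m)) (events-complete a m 1≤a (≤-pred a<1+m) ev∈)

  ∈-potential : ∀ {ev : Event n} {evs} E → ev ∈ evs → avoids N ev E ≤ potential N evs E []
  ∈-potential E (here refl) = ≤-trans (≤-reflexive (sym (*-identityʳ _))) (m≤m+n _ _)
  ∈-potential E (there ev∈) = ≤-trans (∈-potential E ev∈) (m≤n+m _ _)

  expands : ∀ E → potential N (events n) E [] < 1 → Expands (edge-matrix E) K h
  expands E small A T 1≤A T≤K T≤n
    with subsets-complete (count A) A ≤-refl | subsets-complete (K * count A) T T≤K
  ... | A′ , A′∈ , A′≗A | T′ , T′∈ , T′≗T
    with avoids-zero N (A′ , T′) E (n<1⇒n≡0 (≤-<-trans (∈-potential E member) small))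
    where
    same : ∀ {P P′ : Fin n → Bool} → (∀ x → P′ x ≡ P x) → count P′ ≡ count P
    same eq = size-cong (λ x → cong ⟦_⟧ (eq x))
    member : (A′ , T′) ∈ events n
    member = events-complete (count A) n 1≤A (count-≤ A)
      (∈-filter⁺ (valid? (count A)) (∈-cartesianProduct⁺ A′∈ T′∈)
        (same A′≗A , subst (λ c → c + h ≤ n) (sym (same T′≗T)) T≤n))
  ... | u , v , A′u , T′v , uv = u , v , trans (sym (A′≗A u)) A′u , trans (sym (T′≗T v)) T′v , uv

  occ-slots : ∀ vs (u : Fin n) → occ (slots D vs) u ≡ D * occ vs u
  occ-slots []       u = sym (*-zeroʳ D)
  occ-slots (v ∷ vs) u = begin
    occ (replicate D v ++ slots D vs) u              ≡⟨ cong sum (map-++ (λ v → [ v ≡? u ]) (replicate D v) (slots D vs)) ⟩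
    sum (map (λ v → [ v ≡? u ]) (replicate D v) ++ map (λ v → [ v ≡? u ]) (slots D vs))
                                                     ≡⟨ sum-++ (map (λ v → [ v ≡? u ]) (replicate D v)) _ ⟩
    occ (replicate D v) u + occ (slots D vs) u       ≡⟨ cong₂ _+_ (repeat D) (occ-slots vs u) ⟩
    D * [ v ≡? u ] + D * occ vs u                    ≡⟨ *-distribˡ-+ D [ v ≡? u ] (occ vs u) ⟨
    D * ([ v ≡? u ] + occ vs u)                      ∎
    where
    open ≡-Reasoning
    repeat : ∀ d → occ (replicate d v) u ≡ d * [ v ≡? u ]
    repeat zero    = refl
    repeat (suc d) = cong ([ v ≡? u ] +_) (repeat d)

  length-slots : ∀ (vs : List (Fin n)) → length (slots D vs) ≡ length vs * D
  length-slots []       = refl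
  length-slots (v ∷ vs) = trans (length-++ (replicate D v)) (cong₂ _+_ (length-replicate D) (length-slots vs))

  module _ {cap g e} (N+e≤n : N + e ≤ n)
    (saturated-few : ∀ c → c * cap ≤ n * D → 2 * c ≤ e) (ball-small : 2 * suc (D + cap) ^ g ≤ e) where

    open Greedy {n} D cap g N e (events n) N+e≤n saturated-few ball-small

    initial : Inv [] S
    initial = record
      { out = λ u → ≤-reflexive (trans (occ-slots (allFin n) u) (trans (cong (D *_) (once u)) (*-identityʳ D)))
      ; inn = λ _ → z≤n
      ; len = ≤-reflexive (trans (length-slots (allFin n)) (cong (_* D) (length-tabulate {n = n} (λ x → x))))
      ; loopless = λ _ → refl
      ; girth = λ { (suc (suc m)) (_ , _ , _ , e , _) → contradiction (e F.zero) λ () ; (suc zero) (s≤s () , _) } }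
      where
      once : ∀ u → occ (allFin n) u ≡ 1
      once u = trans (cong sum (map-tabulate (λ x → x) (λ v → [ v ≡? u ]))) (size-[≡?] u)

    expander-exists : ∃ λ (E : Edges n) → Σ (∀ u → edge-matrix E u u ≡ false) λ loopless →
      GirthAtLeast (graph (edge-matrix E) (edge-matrix-sym E) loopless) g × Expands (edge-matrix E) K h
    expander-exists with complete S [] initial initial-potential
    ... | E , inv , small = E , Inv.loopless inv , Inv.girth inv , expands E small

-- Choice of parameters

≤-slack : ∀ {a b} r → a + r ≡ b → a ≤ b
≤-slack {a} r eq = subst (a ≤_) eq (m≤m+n a r)

-- Bernoulli's inequality 1 + xp/t ≤ (1 + p/t)^x, multiplied by t^(x+1).
bernoulli : ∀ t p x → t ^ x * (t + x * p) ≤ t * (t + p) ^ x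
bernoulli t p zero    = ≤-reflexive (base t)
  where
  base : ∀ t → 1 * (t + 0) ≡ t * 1
  base = solve-∀
bernoulli t p (suc x) = begin
  t * t ^ x * (t + (p + x * p))              ≤⟨ ≤-slack (t ^ x * (x * p * p)) (expand t p x (t ^ x)) ⟩
  (t + p) * (t ^ x * (t + x * p))            ≤⟨ *-monoʳ-≤ (t + p) (bernoulli t p x) ⟩
  (t + p) * (t * (t + p) ^ x)                ≡⟨ swap (t + p) t _ ⟩
  t * ((t + p) * (t + p) ^ x)                ∎
  where
  open ≤-Reasoning
  expand : ∀ t p x w → t * w * (t + (p + x * p)) + w * (x * p * p) ≡ (t + p) * (w * (t + x * p))
  expand = solve-∀
  swap : ∀ a b c → a * (b * c) ≡ b * (a * c)
  swap = solve-∀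

-- Since t ≤ xp, the left side of Bernoulli's inequality is at least 2. For t = 0 the claim rests on
-- x ≥ 1, which makes the power vanish.
doubling : ∀ {t p x N} → 1 ≤ x → t ≤ x * p → t + p ≤ N → 2 * t ^ x ≤ N ^ x
doubling {zero}  {p} {suc x} 1≤x t≤ ≤N = z≤n
doubling {t@(suc _)} {p} {x} {N} 1≤x t≤ ≤N = *-cancelˡ-≤ t (begin
  t * (2 * t ^ x)             ≡⟨ regroup t (t ^ x) ⟩
  t ^ x * (t + t)             ≤⟨ *-monoʳ-≤ (t ^ x) (+-monoʳ-≤ t t≤) ⟩
  t ^ x * (t + x * p)         ≤⟨ bernoulli t p x ⟩
  t * (t + p) ^ x             ≤⟨ *-monoʳ-≤ t (^-monoˡ-≤ x ≤N) ⟩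
  t * N ^ x                   ∎)
  where
  open ≤-Reasoning
  regroup : ∀ t w → t * (2 * w) ≡ w * (t + t)
  regroup = solve-∀

^-distrib-* : ∀ a b k → (a * b) ^ k ≡ a ^ k * b ^ k
^-distrib-* a b zero    = refl
^-distrib-* a b (suc k) = trans (cong (a * b *_) (^-distrib-* a b k)) (interchange a b (a ^ k) (b ^ k))
  where
  interchange : ∀ a b c d → (a * b) * (c * d) ≡ (a * c) * (b * d)
  interchange = solve-∀

exponential-decay : ∀ {t p x N} y → 1 ≤ x → t ≤ x * p → t + p ≤ N → 2 ^ y * t ^ (x * y) ≤ N ^ (x * y)
exponential-decay {t} {p} {x} {N} y 1≤x t≤ ≤N = begin
  2 ^ y * t ^ (x * y)        ≡⟨ cong (2 ^ y *_) (^-*-assoc t x y) ⟨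
  2 ^ y * (t ^ x) ^ y        ≡⟨ ^-distrib-* 2 (t ^ x) y ⟨
  (2 * t ^ x) ^ y            ≤⟨ ^-monoˡ-≤ y (doubling {t} {p} {x} {N} 1≤x t≤ ≤N) ⟩
  (N ^ x) ^ y                ≡⟨ ^-*-assoc N x y ⟩
  N ^ (x * y)                ∎
  where open ≤-Reasoning

n<2^n : ∀ n → n < 2 ^ n
n<2^n zero    = s≤s z≤n
n<2^n (suc n) = ≤-trans (+-mono-≤ (m^n>0 2 n) (n<2^n n)) (≤-reflexive (cong (2 ^ n +_) (sym (+-identityʳ _))))

quotient : ∀ n d → 1 ≤ d → ∃ λ q → d * q ≤ n × n < d * suc q
quotient n d@(suc _) _ = n / d , ≤-trans (≤-reflexive (*-comm d (n / d))) (m/n*n≤m n d) , (begin-strict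
  n                        ≡⟨ m≡m%n+[m/n]*n n d ⟩
  n % d + n / d * d        <⟨ +-monoˡ-< (n / d * d) (m%n<n n d) ⟩
  d + n / d * d            ≡⟨ *-comm (suc (n / d)) d ⟩
  d * suc (n / d)          ∎)
  where open ≤-Reasoning

bracket : ∀ (f : ℕ → ℕ) m n → f m ≤ n → (∀ k → k < f k) → ∃ λ k → m ≤ k × f k ≤ n × n < f (suc k)
bracket f m n fm≤n f-grows = search n (≤-<-trans (m≤m+n n m) (f-grows (n + m)))
  where
  search : ∀ d → n < f (d + m) → ∃ λ k → m ≤ k × f k ≤ n × n < f (suc k)
  search zero    n<f = contradiction fm≤n (<⇒≱ n<f)
  search (suc d) n<f with f (d + m) ≤? n
  ... | yes f≤n = d + m , m≤n+m m d , f≤n , n<f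
  ... | no  f≰n = search d (≰⇒> f≰n)

-- With at most one pebble on each vertex no step is possible, and fewer than n pebbles leave some
-- vertex empty.
unsolvable-below : ∀ {n} (G : Graph n) m → m < n → ∃ λ (C : Config n) → size C ≡ m × ¬ Solvable G C
unsolvable-below {n} G m m<n with truncate {n} (λ _ → true) m
  (≤-trans (<⇒≤ m<n) (≤-reflexive (sym (size-1 {n}))))
... | q , q≡m , _ with count-< {p = q} {λ _ → true}
  (subst₂ _<_ (sym q≡m) (sym (size-1 {n})) m<n)
... | r , qr , _ = (λ v → ⟦ q v ⟧) , q≡m , λ solvable → stuck (solvable r)
  where
  stuck : ¬ RSolvable G (λ v → ⟦ q v ⟧) r
  stuck (_ , ε , 1≤) = contradiction (subst (λ b → 1 ≤ ⟦ b ⟧) qr 1≤) λ ()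
  stuck (_ , step u v _ 2≤ ◅ _ , _) = contradiction (≤-trans 2≤ (⟦⟧≤1 (q u))) λ { (s≤s ()) }

class-0-from-parameters : ∀ {n g N D K h y cap e t s} → 1 ≤ N →
  suc n ^ (2 + K) ≤ 2 ^ y → (∀ t → t + h ≤ n → 2 ^ y * t ^ D ≤ N ^ D) →
  N + e ≤ n → (∀ c → c * cap ≤ n * D → 2 * c ≤ e) → 2 * suc (D + cap) ^ g ≤ e →
  1 ≤ h → s ≡ 2 ^ (t + t) → K ≡ 8 * (s * s) → n ≤ K ^ t → 4 * (s * h) ≤ n → K ≤ n → 1 ≤ K →
  Σ (Graph n) λ G → GirthAtLeast G g × PebblingNumberIs G n
class-0-from-parameters {n} {g} {N} {D} {K} {h} {y} {cap} {e} {t} {s}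
  1≤N events-few decay N+e≤n saturated-few ball-small 1≤h s≡ K≡ n≤K^t 4sh≤n K≤n 1≤K
  with expander-exists {n} N D K h y 1≤N events-few decay {cap} {g} {e} N+e≤n saturated-few ball-small
     | quotient n K 1≤K
... | E , loopless , girth , ex | q , Kq≤n , n<Kq =
  graph (edge-matrix E) (edge-matrix-sym E) loopless , girth ,
  (λ C C≡n r → Solve.solvable (edge-matrix E) (edge-matrix-sym E) loopless K h t s q ex
    1≤h s≡ K≡ n≤K^t 4sh≤n K≤n Kq≤n (<⇒≤ n<Kq) C C≡n r) ,
  unsolvable-below _

module Parameters (g n : ℕ) (16≤g : 16 ≤ g) where

  g≤gg : g ≤ g * g
  g≤gg = m≤m*n g g {{>-nonZero (≤-trans (s≤s z≤n) 16≤g)}}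

  module _ (n≥ : 2 ^ (40 * (g * g)) ≤ n) (n≤ : n ≤ 2 ^ (60 * (g * g))) where

    -- `a` is 2t for t = 4g. With e = n / (8s) rounded down, `x` satisfies n ≤ x · e, so x choices
    -- halve the chance of staying in a set of size at most N - e, and `y` blocks of x choices give
    -- 2^(-y). `cap` is 2 · x · D, so that at most nD / cap ≤ e / 2 vertices are saturated.
    a s K x y D cap : ℕ
    a   = 4 * g + 4 * g
    s   = 2 ^ a
    K   = 8 * (s * s)
    x   = 16 * s
    y   = 2 ^ (20 * g)
    D   = x * y
    cap = 32 * s * D

    1≤s : 1 ≤ s
    1≤s = m^n>0 2 a

    1≤8s : 1 ≤ 8 * s
    1≤8s = *-mono-≤ {1} {8} (s≤s z≤n) 1≤s

    K≡2^ : K ≡ 2 ^ (3 + (a + a))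
    K≡2^ = trans (expand (s * s)) (cong (λ w → 2 * (2 * (2 * w))) (sym (^-distribˡ-+-* 2 a a)))
      where
      expand : ∀ w → 8 * w ≡ 2 * (2 * (2 * w))
      expand = solve-∀

    D≡2^ : D ≡ 2 ^ (4 + (a + 20 * g))
    D≡2^ = trans (expand s y) (cong (λ w → 2 * (2 * (2 * (2 * w)))) (sym (^-distribˡ-+-* 2 a (20 * g))))
      where
      expand : ∀ s y → 16 * s * y ≡ 2 * (2 * (2 * (2 * (s * y))))
      expand = solve-∀

    1≤D : 1 ≤ D
    1≤D = subst (1 ≤_) (sym D≡2^) (m^n>0 2 (4 + (a + 20 * g)))

    1≤K : 1 ≤ K
    1≤K = subst (1 ≤_) (sym K≡2^) (m^n>0 2 (3 + (a + a)))

    suc-degree≤ : suc (D + cap) ≤ 2 ^ (37 * g)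
    suc-degree≤ = begin
      suc (D + cap)                        ≤⟨ +-mono-≤ 1≤cap (+-monoˡ-≤ cap D≤cap) ⟩
      cap + (cap + cap)                    ≤⟨ ≤-slack cap (four cap) ⟩
      2 * (2 * cap)                        ≡⟨ cong (λ w → 2 * (2 * w)) cap≡2^ ⟩
      2 ^ (2 + (5 + (a + (4 + (a + 20 * g))))) ≡⟨ cong (2 ^_) (exponent g) ⟩
      2 ^ (11 + 36 * g)                    ≤⟨ ^-monoʳ-≤ 2 {11 + 36 * g} {37 * g} (+-monoˡ-≤ (36 * g) {11} {g} (≤-trans {11} {16} (m≤m+n 11 5) 16≤g)) ⟩
      2 ^ (37 * g)                         ∎
      where
      open ≤-Reasoning
      four : ∀ c → c + (c + c) + c ≡ 2 * (2 * c)
      four = solve-∀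
      expand : ∀ s d → 32 * s * d ≡ 2 * (2 * (2 * (2 * (2 * (s * d)))))
      expand = solve-∀
      cap≡2^ : cap ≡ 2 ^ (5 + (a + (4 + (a + 20 * g))))
      cap≡2^ = trans (expand s D) (cong (λ w → 2 * (2 * (2 * (2 * (2 * w)))))
        (trans (cong (s *_) D≡2^) (sym (^-distribˡ-+-* 2 a (4 + (a + 20 * g))))))
      D≤cap : D ≤ cap
      D≤cap = ≤-trans (≤-reflexive (sym (*-identityˡ D))) (*-monoˡ-≤ D (*-mono-≤ {1} {32} (s≤s z≤n) 1≤s))
      1≤cap : 1 ≤ cap
      1≤cap = ≤-trans 1≤D D≤cap
      exponent : ∀ g → 2 + (5 + ((4 * g + 4 * g) + (4 + ((4 * g + 4 * g) + 20 * g)))) ≡ 11 + 36 * g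
      exponent = solve-∀

    module _ (e : ℕ) (8se≤n : 8 * s * e ≤ n) (n<8s[1+e] : n < 8 * s * suc e) where

      -- The degree is below 2^(37g), so balls of radius `g` need 2^(37g²). The lower bound 2^(40g²)
      -- on n leaves 2^(3g²) to absorb 16s = 2^(4+8g).
      e-large : 2 * 2 ^ (37 * (g * g)) ≤ e
      e-large with 2 ^ (1 + 37 * (g * g)) ≤? e
      ... | yes le = le
      ... | no  lt = contradiction n≥ (<⇒≱ (begin-strict
        n                                            <⟨ n<8s[1+e] ⟩
        8 * s * suc e                                ≤⟨ *-monoʳ-≤ (8 * s) (≰⇒> lt) ⟩
        8 * s * 2 ^ (1 + 37 * (g * g))               ≡⟨ expand s (2 ^ (1 + 37 * (g * g))) ⟩
        2 * (2 * (2 * (s * 2 ^ (1 + 37 * (g * g))))) ≡⟨ cong (λ w → 2 * (2 * (2 * w))) (sym (^-distribˡ-+-* 2 a (1 + 37 * (g * g)))) ⟩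
        2 ^ (3 + (a + (1 + 37 * (g * g))))           ≤⟨ ^-monoʳ-≤ 2 {3 + (a + (1 + 37 * (g * g)))} {40 * (g * g)} exponent≤ ⟩
        2 ^ (40 * (g * g))                           ∎))
        where
        open ≤-Reasoning
        expand : ∀ s w → 8 * s * w ≡ 2 * (2 * (2 * (s * w)))
        expand = solve-∀
        split : ∀ g w → 3 + ((4 * g + 4 * g) + (1 + 37 * w)) ≡ (4 + 8 * g) + 37 * w
        split = solve-∀
        join : ∀ w → (w + w) + 37 * w + w ≡ 40 * w
        join = solve-∀
        exponent≤ : 3 + (a + (1 + 37 * (g * g))) ≤ 40 * (g * g)
        exponent≤ = begin
          3 + (a + (1 + 37 * (g * g)))           ≡⟨ split g (g * g) ⟩
          (4 + 8 * g) + 37 * (g * g)             ≤⟨ +-monoˡ-≤ (37 * (g * g)) (+-mono-≤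
                                                      (≤-trans (m≤m+n 4 12) (≤-trans 16≤g g≤gg))
                                                      (*-monoˡ-≤ g (≤-trans (m≤m+n 8 8) 16≤g))) ⟩
          (g * g + g * g) + 37 * (g * g)         ≤⟨ ≤-slack (g * g) (join (g * g)) ⟩
          40 * (g * g)                           ∎

      1≤e : 1 ≤ e
      1≤e = ≤-trans (m^n>0 2 (1 + 37 * (g * g))) e-large

      n≤xe : n ≤ x * e
      n≤xe = begin
        n                        ≤⟨ <⇒≤ n<8s[1+e] ⟩
        8 * s * suc e            ≤⟨ *-monoʳ-≤ (8 * s) (+-monoˡ-≤ e 1≤e) ⟩
        8 * s * (e + e)          ≡⟨ double s e ⟩
        x * e                    ∎
        where
        open ≤-Reasoning
        double : ∀ s e → 8 * s * (e + e) ≡ 16 * s * e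
        double = solve-∀

      -- A set `T` leaves out h = 2e vertices: e of them pay for the forbidden targets, and the
      -- other e form the gap between `T` and N that drives the decay. The choice of e gives 4sh =
      -- 8se ≤ n.
      h N : ℕ
      h = 2 * e
      N = n ∸ e

      2e≤n : e + e ≤ n
      2e≤n = ≤-trans (≤-trans (≤-reflexive (cong (e +_) (sym (+-identityʳ e)))) (*-monoˡ-≤ e 2≤8s)) 8se≤n

        where
        2≤8s : 2 ≤ 8 * s
        2≤8s = *-mono-≤ {2} {8} (s≤s (s≤s z≤n)) 1≤s

      N+e≡n : N + e ≡ n
      N+e≡n = m∸n+n≡m (≤-trans (m≤m+n e e) 2e≤n)

      1≤N : 1 ≤ N
      1≤N = ≤-trans 1≤e (m+n≤o⇒m≤o∸n e 2e≤n)

      decay : ∀ t → t + h ≤ n → 2 ^ y * t ^ D ≤ N ^ D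
      decay t t+h≤n = exponential-decay {t} {e} {x} {N} y (*-mono-≤ {1} {16} (s≤s z≤n) 1≤s)
        (≤-trans (≤-trans (m≤m+n t h) t+h≤n) n≤xe)
        (+-cancelʳ-≤ e _ _ (≤-trans (≤-reflexive (regroup t e)) (≤-trans t+h≤n (≤-reflexive (sym N+e≡n)))))
        where
        regroup : ∀ t e → (t + e) + e ≡ t + 2 * e
        regroup = solve-∀

      -- This fixes the size of `y`: it must exceed (K + 2) · lg(n + 1), whose factors are at most
      -- 2^(5+16g) and 2^(6+2g).
      events-few : suc n ^ (2 + K) ≤ 2 ^ y
      events-few = begin
        suc n ^ (2 + K)                      ≤⟨ ^-monoˡ-≤ (2 + K) suc-n≤ ⟩
        (2 ^ (1 + 60 * (g * g))) ^ (2 + K)   ≡⟨ ^-*-assoc 2 (1 + 60 * (g * g)) (2 + K) ⟩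
        2 ^ ((1 + 60 * (g * g)) * (2 + K))   ≤⟨ ^-monoʳ-≤ 2 {(1 + 60 * (g * g)) * (2 + K)} {y} exponent≤ ⟩
        2 ^ y                                ∎
        where
        open ≤-Reasoning
        suc-n≤ : suc n ≤ 2 ^ (1 + 60 * (g * g))
        suc-n≤ = ≤-trans (+-mono-≤ (m^n>0 2 (60 * (g * g))) n≤) (≤-reflexive (cong (2 ^ (60 * (g * g)) +_) (sym (+-identityʳ _))))
        expand : ∀ w → 64 * w ≡ 2 * (2 * (2 * (2 * (2 * (2 * w)))))
        expand = solve-∀
        first : 1 + 60 * (g * g) ≤ 2 ^ (6 + (g + g))
        first = begin
          1 + 60 * (g * g)             ≤⟨ +-monoˡ-≤ (60 * (g * g)) (*-mono-≤ {1} {4} (s≤s z≤n) (≤-trans (m≤m+n 1 15) (≤-trans 16≤g g≤gg))) ⟩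
          4 * (g * g) + 60 * (g * g)   ≡⟨ *-distribʳ-+ (g * g) 4 60 ⟨
          64 * (g * g)                 ≤⟨ *-monoʳ-≤ 64 (*-mono-≤ (<⇒≤ (n<2^n g)) (<⇒≤ (n<2^n g))) ⟩
          64 * (2 ^ g * 2 ^ g)         ≡⟨ cong (64 *_) (^-distribˡ-+-* 2 g g) ⟨
          64 * 2 ^ (g + g)             ≡⟨ expand (2 ^ (g + g)) ⟩
          2 ^ (6 + (g + g))            ∎
        second : 2 + K ≤ 2 ^ (5 + (a + a))
        second = begin
          2 + K                        ≤⟨ +-monoˡ-≤ K (*-mono-≤ {2} {2} ≤-refl 1≤K) ⟩
          2 * K + K                    ≤⟨ ≤-slack K (four K) ⟩
          2 * (2 * K)                  ≡⟨ cong (λ w → 2 * (2 * w)) K≡2^ ⟩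
          2 ^ (5 + (a + a))            ∎
          where
          four : ∀ c → 2 * c + c + c ≡ 2 * (2 * c)
          four = solve-∀
        short : 11 + 18 * g ≤ 20 * g
        short = begin
          11 + 18 * g        ≤⟨ +-monoˡ-≤ (18 * g) {11} {2 * g} (≤-trans {11} {16} (m≤m+n 11 5) (≤-trans 16≤g (m≤m+n g (g + 0)))) ⟩
          2 * g + 18 * g     ≡⟨ *-distribʳ-+ g 2 18 ⟨
          20 * g             ∎
        split : ∀ g → (6 + (g + g)) + (5 + ((4 * g + 4 * g) + (4 * g + 4 * g))) ≡ 11 + 18 * g
        split = solve-∀
        exponent≤ : (1 + 60 * (g * g)) * (2 + K) ≤ y
        exponent≤ = begin
          (1 + 60 * (g * g)) * (2 + K)             ≤⟨ *-mono-≤ first second ⟩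
          2 ^ (6 + (g + g)) * 2 ^ (5 + (a + a))    ≡⟨ ^-distribˡ-+-* 2 (6 + (g + g)) (5 + (a + a)) ⟨
          2 ^ ((6 + (g + g)) + (5 + (a + a)))      ≡⟨ cong (2 ^_) (split g) ⟩
          2 ^ (11 + 18 * g)                        ≤⟨ ^-monoʳ-≤ 2 {11 + 18 * g} {20 * g} short ⟩
          2 ^ (20 * g)                             ∎

      saturated-few : ∀ c → c * cap ≤ n * D → 2 * c ≤ e
      saturated-few c le = *-cancelˡ-≤ (x * D) {{>-nonZero (*-mono-≤ (*-mono-≤ {1} {16} (s≤s z≤n) 1≤s) 1≤D)}} (begin
        x * D * (2 * c)          ≡⟨ regroup s D c ⟩
        c * cap                  ≤⟨ le ⟩
        n * D                    ≤⟨ *-monoˡ-≤ D n≤xe ⟩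
        x * e * D                ≡⟨ swap x e D ⟩
        x * D * e                ∎)
        where
        open ≤-Reasoning
        regroup : ∀ s d c → 16 * s * d * (2 * c) ≡ c * (32 * s * d)
        regroup = solve-∀
        swap : ∀ x e d → x * e * d ≡ x * d * e
        swap = solve-∀

      ball-small : 2 * suc (D + cap) ^ g ≤ e
      ball-small = ≤-trans (*-monoʳ-≤ 2 (≤-trans (^-monoˡ-≤ g suc-degree≤)
        (≤-reflexive (trans (^-*-assoc 2 (37 * g) g) (cong (2 ^_) (*-assoc 37 g g)))))) e-large

      -- K^t is 2^(64g² + 12g); this is why n is kept below 2^(60g²).
      n≤K^t : n ≤ K ^ (4 * g)
      n≤K^t = begin
        n                                    ≤⟨ n≤ ⟩
        2 ^ (60 * (g * g))                   ≤⟨ ^-monoʳ-≤ 2 {60 * (g * g)} {(3 + (a + a)) * (4 * g)} (≤-slack (4 * (g * g) + 12 * g) (exponent g)) ⟩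
        2 ^ ((3 + (a + a)) * (4 * g))        ≡⟨ ^-*-assoc 2 (3 + (a + a)) (4 * g) ⟨
        (2 ^ (3 + (a + a))) ^ (4 * g)        ≡⟨ cong (_^ (4 * g)) K≡2^ ⟨
        K ^ (4 * g)                          ∎
        where
        open ≤-Reasoning
        exponent : ∀ g → 60 * (g * g) + (4 * (g * g) + 12 * g) ≡ (3 + ((4 * g + 4 * g) + (4 * g + 4 * g))) * (4 * g)
        exponent = solve-∀

      K≤n : K ≤ n
      K≤n = ≤-trans (≤-reflexive K≡2^) (≤-trans (^-monoʳ-≤ 2 {3 + (a + a)} {40 * (g * g)} exponent≤) n≥)
        where
        open ≤-Reasoning
        split : ∀ g → 3 + ((4 * g + 4 * g) + (4 * g + 4 * g)) ≡ 3 + 16 * g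
        split = solve-∀
        join : ∀ w → (w + w) + 38 * w ≡ 40 * w
        join = solve-∀
        exponent≤ : 3 + (a + a) ≤ 40 * (g * g)
        exponent≤ = begin
          3 + (a + a)                            ≡⟨ split g ⟩
          3 + 16 * g                             ≤⟨ +-mono-≤ {3} {g * g} {16 * g} {g * g} (≤-trans {3} {16} (m≤m+n 3 13) (≤-trans 16≤g g≤gg)) (*-monoˡ-≤ g 16≤g) ⟩
          g * g + g * g                          ≤⟨ ≤-slack (38 * (g * g)) (join (g * g)) ⟩
          40 * (g * g)                           ∎

      4sh≤n : 4 * (s * h) ≤ n
      4sh≤n = ≤-trans (≤-reflexive (regroup s e)) 8se≤n
        where
        regroup : ∀ s e → 4 * (s * (2 * e)) ≡ 8 * s * e
        regroup = solve-∀

      result : Σ (Graph n) λ G → GirthAtLeast G g × PebblingNumberIs G n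
      result = class-0-from-parameters {n} {g} {N} {D} {K} {h} {y} {cap} {e} {4 * g} {s} 1≤N events-few decay
        (≤-reflexive N+e≡n) saturated-few ball-small (≤-trans 1≤e (m≤m+n e _)) refl refl n≤K^t 4sh≤n K≤n 1≤K

    class-0-graph : Σ (Graph n) λ G → GirthAtLeast G g × PebblingNumberIs G n
    class-0-graph = result (proj₁ division) (proj₁ (proj₂ division)) (proj₂ (proj₂ division))
      where
      division : ∃ λ e → 8 * s * e ≤ n × n < 8 * s * suc e
      division = quotient n (8 * s) 1≤8s

threshold : ℕ → ℕ
threshold g = 2 ^ (40 * (g * g))

g<threshold : ∀ g → g < threshold g
g<threshold g = <-≤-trans (n<2^n g) (^-monoʳ-≤ 2 (≤-trans (square g) (m≤n*m (g * g) 40)))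
  where
  square : ∀ g → g ≤ g * g
  square zero    = z≤n
  square (suc g) = m≤m*n (suc g) (suc g)

-- The admissible ranges from 2^(40g²) to 2^(60g²) thus leave no gap from g = 16 on, so every large
-- n falls into one of them.
threshold-suc : ∀ g → 16 ≤ g → threshold (suc g) ≤ 2 ^ (60 * (g * g))
threshold-suc g 16≤g = ^-monoʳ-≤ 2 {40 * (suc g * suc g)} {60 * (g * g)} (begin
  40 * (suc g * suc g)                        ≡⟨ split g ⟩
  40 * (g * g) + (5 * (16 * g) + 40)          ≤⟨ +-monoʳ-≤ (40 * (g * g)) (+-mono-≤ (*-monoʳ-≤ 5 (*-monoˡ-≤ g 16≤g))
                                                   (≤-trans (m≤m+n 40 8) (*-monoʳ-≤ 3 (≤-trans 16≤g g≤gg)))) ⟩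
  40 * (g * g) + (5 * (g * g) + 3 * (g * g))  ≤⟨ ≤-slack (12 * (g * g)) (join (g * g)) ⟩
  60 * (g * g)                                ∎)
  where
  open ≤-Reasoning
  g≤gg : g ≤ g * g
  g≤gg = m≤m*n g g {{>-nonZero (≤-trans (s≤s z≤n) 16≤g)}}
  split : ∀ g → 40 * (suc g * suc g) ≡ 40 * (g * g) + (5 * (16 * g) + 40)
  split = solve-∀
  join : ∀ w → 40 * w + (5 * w + 3 * w) + 12 * w ≡ 60 * w
  join = solve-∀

theorem5 : Σ ℕ λ n₀ → Σ ℕ λ a → Σ ℕ λ b → 0 < a × 0 < b ×
    (∀ n → n₀ ≤ n →
    Σ (Graph n) λ G → Σ ℕ λ g →
    n ^ a ≤ 2 ^ (b * (g * g)) × GirthAtLeast G g × PebblingNumberIs G n)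
-- The exponents encode c = √(1/60): n ≤ 2^(60g²) says that g ≥ √(lg n / 60).
theorem5 = threshold 16 , 1 , 60 , s≤s z≤n , s≤s z≤n , λ n n₀≤n → build n (bracket threshold 16 n n₀≤n g<threshold)
  where
  build : ∀ n → (∃ λ g → 16 ≤ g × threshold g ≤ n × n < threshold (suc g)) →
    Σ (Graph n) λ G → Σ ℕ λ g → n ^ 1 ≤ 2 ^ (60 * (g * g)) × GirthAtLeast G g × PebblingNumberIs G n
  build n (g , 16≤g , n≥ , n<) = proj₁ class-0 , g , ≤-trans (≤-reflexive (*-identityʳ n)) n≤ , proj₂ class-0
    where
    n≤ : n ≤ 2 ^ (60 * (g * g))
    n≤ = ≤-trans (<⇒≤ n<) (threshold-suc g 16≤g)
    class-0 : Σ (Graph n) λ G → GirthAtLeast G g × PebblingNumberIs G n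
    class-0 = Parameters.class-0-graph g n 16≤g n≥ n≤
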